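{- Let $p$ be a prime and let $s,d,r$ be positive integers with $r\le s$. Let $\mathcal{R}$ be a finite chain ring with maximal ideal $I=(\pi)$ such that $I^{s-1}\neq 0$, $I^s=0$, $p$ is an associate of $\pi^r$, and $\mathcal{R}/I$ is a field with $p^d$ elements. Let $w,z_1,z_2$ be integers with $1\le w\le p^d$, $1\le z_1\le p^d-w+1$ and $1\le z_2\le p^{sd}$, and let $\mathcal{S}=\{S_{i,j}\}_{0\le i,j\le z_1}$ be any family of subsets of $G=H\times H$ (with $H$ the additive group of $\mathcal{R}$) obtained by the construction described in the context. Then $\mathcal{S}$ is a partial sum family if and only if $z_2\in\{w-1,w\}$ in the case $2\le w\le p^d$, and $z_2=1$ in the case $w=1$. Furthermore, in that case its parameters are $$(m,n,k,\lambda,\mu,t)=\bigl(z_1+1,\ p^{2sd},\ (p^{sd}-1)w+z_1z_2p^{sd},\ p^{sd}+w^2-3w+z_1z_2^2,\ w^2-w+z_1z_2^2,\ p^{sd}w-w+z_1z_2^2\bigr).$$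
   Context: A finite chain ring is a finite commutative local ring whose maximal ideal is principal. Here $|\mathcal{R}|=p^{sd}$. Partial sum family: let $G$ be a finite abelian group of order $n$ with identity $e$. A family $\{S_{i,j}\}_{0\le i,j\le m-1}$ of subsets of $G$ is an $(m,n,k,\lambda,\mu,t)$-partial sum family if (1) $e\notin S_{i,i}$ for all $i$; (2) $\sum_{j=0}^{m-1}|S_{i,j}|=\sum_{j=0}^{m-1}|S_{j,i}|=k$ for all $i$; (3) for all $0\le i,j\le m-1$, in the group ring $\mathbb{Z}[G]$ one has $\sum_{l=0}^{m-1}S_{l,j}S_{i,l}=\mu G+\beta S_{i,j}+\delta_{i,j}\gamma e$, where $\beta=\lambda-\mu$, $\gamma=t-\mu$ and $\delta_{i,j}$ is the Kronecker delta. A subset $S\subseteq G$ is identified with $\sum_{g\in S}g\in\mathbb{Z}[G]$. It is a partial sum family if this holds for some parameters. Construction of $\mathcal{S}$: let $0_G=(0,0)$ be the identity of $G=H\times H$. Let $J\subset\mathcal{R}$ be a fixed system of coset representatives of $\mathcal{R}$ modulo $I$, and $J'=J\cup\{\infty\}$. For $a\in J$ put $L_a=\{(x,ax):x\in\mathcal{R}\}$, and put $L_\infty=\{(0,x):x\in\mathcal{R}\}$; these are subgroups of $G$. Label the elements of $J'$ as $a_0=\infty,a_1,\dots,a_{p^d}$. For $0\le i\le j\le p^d$ let $D_{[i,j]}=\{a_i,a_{i+1},\dots,a_j\}$. Choose integers $0\le k_0<k_1<\dots<k_{z_1}\le p^d-w+1$ and put $A_i=D_{[k_i,w+k_i-1]}$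 for $0\le i\le z_1$. For $0\le i\neq j\le z_1$ let $b_{i,j}=a_{k_i}$ if $i<j$ and $b_{i,j}=a_{w+k_i-1}$ if $i>j$, and let $T_{i,j}$ be a set of $z_2$ elements of $G$ lying in pairwise distinct cosets of $L_{b_{i,j}}$ (a size-$z_2$ subset of a system of coset representatives of $L_{b_{i,j}}$ in $G$). Define $$S_{i,i}=\bigcup_{a\in A_i}L_a\setminus\{0_G\}\quad(0\le i\le z_1),\qquad S_{i,j}=\bigcup_{g\in T_{i,j}}(g+L_{b_{i,j}})\quad(0\le i\neq j\le z_1).$$ -}

module Defs where

open import Level using (_⊔_; Lift; lift) renaming (suc to lsuc)
open import Algebra.Bundles using (AbelianGroup; CommutativeRing)
import Algebra.Construct.DirectProduct as DirectProduct
import Algebra.Definitions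
import Algebra.Properties.CommutativeMonoid.Sum
import Algebra.Properties.CommutativeSemigroup
import Algebra.Properties.Ring
import Algebra.Properties.Semiring.Divisibility
import Algebra.Properties.Semiring.Exp
import Algebra.Properties.Semiring.Mult
open import Data.Bool.Base using (if_then_else_)
open import Data.Fin.Base using (Fin; zero; suc; toℕ; fromℕ<)
import Data.Fin.Base as Fin
import Data.Fin.Properties as Fin
open import Data.Integer.Base using (ℤ; 0ℤ; 1ℤ)
import Data.Integer.Base as ℤ
import Data.Integer.Properties as ℤ
open import Data.Nat.Base using (ℕ; zero; suc; _∸_; _≤_; _<_; s≤s)
import Data.Nat.Base as ℕ
import Data.Nat.Properties as ℕ
open import Data.Product.Base using (_×_; _,_; ∃; ∃-syntax)
open import Data.Product.Function.NonDependent.Setoid using (_×-inverse_)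
open import Data.Product.Relation.Binary.Pointwise.NonDependent using (Pointwise-≡↔≡)
open import Data.Unit.Base using (⊤; tt)
open import Function.Base using (_∘_)
open import Function.Bundles using (Inverse)
open import Function.Construct.Composition using (inverse)
open import Function.Construct.Symmetry using () renaming (inverse to inverse-sym)
open import Function.Definitions using (Bijective)
open import Function.Properties.Inverse using (Inverse⇒Injection)
open import Relation.Binary.Bundles using (Setoid)
open import Relation.Binary.Definitions using () renaming (Decidable to Decidable₂)
open import Relation.Binary.PropositionalEquality as ≡ using (_≡_; _≢_)
open import Relation.Nullary using (¬_; Dec; yes; no; does)
open import Relation.Nullary.Decidable using (map′; _×-dec_; ¬?; via-injection)
open import Relation.Unary using (Pred; Decidable; _∈_; _∉_; _⊆_; _≐_)

HasOrder : ∀ {a ℓ} → Setoid a ℓ → ℕ → Set (a ⊔ ℓ)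
HasOrder A n = Inverse A (≡.setoid (Fin n))

module FiniteSetoid {a ℓ} (A : Setoid a ℓ) {n} (A≅n : HasOrder A n) where
  open Setoid A
  open Inverse A≅n

  _≈?_ : Decidable₂ _≈_
  _≈?_ = via-injection (Inverse⇒Injection A≅n) Fin._≟_

  any? : ∀ {p} {P : Pred Carrier p} →
         (∀ {x y} → x ≈ y → P x → P y) → Decidable P → Dec (∃ P)
  any? resp P? = map′
    (λ (i , q) → from i , q)
    (λ (x , q) → to x , resp (sym (strictlyInverseʳ x)) q)
    (Fin.any? (P? ∘ from))

record Ideal {c ℓ} (R : CommutativeRing c ℓ) : Set (lsuc (c ⊔ ℓ)) where
  open CommutativeRing R
  field
    Member   : Pred Carrier (c ⊔ ℓ)
    resp     : ∀ {x y} → x ≈ y → Member x → Member y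
    0-closed : Member 0#
    +-closed : ∀ {x y} → Member x → Member y → Member (x + y)
    *-closed : ∀ r {x} → Member x → Member (r * x)

open Ideal using (Member)

module _ {c ℓ} {R : CommutativeRing c ℓ} where
  open CommutativeRing R hiding (zero)

  -- "Every ideal K ⊇ I is I or R" is stated as: every proper K ⊇ I is
  -- contained in I.  A disjunction ranging over arbitrary predicates K
  -- would amount to excluded middle.
  record IsMaximal (I : Ideal R) : Set (lsuc (c ⊔ ℓ)) where
    field
      proper  : 1# ∉ Member I
      maximal : ∀ (K : Ideal R) → Member I ⊆ Member K → 1# ∉ Member K →
                Member K ⊆ Member I

  record IsUniqueMaximal (I : Ideal R) : Set (lsuc (c ⊔ ℓ)) where
    field
      isMaximal : IsMaximal I
      unique    : ∀ (M : Ideal R) → IsMaximal M → Member M ≐ Member I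

  IsZero : Ideal R → Set (c ⊔ ℓ)
  IsZero I = ∀ {x} → x ∈ Member I → x ≈ 0#

  data Generated (P : Pred Carrier (c ⊔ ℓ)) : Pred Carrier (c ⊔ ℓ) where
    generator : ∀ {x} → P x → Generated P x
    ≈-closed  : ∀ {x y} → x ≈ y → Generated P x → Generated P y
    0-member  : Generated P 0#
    sum       : ∀ {x y} → Generated P x → Generated P y → Generated P (x + y)
    multiple  : ∀ r {x} → Generated P x → Generated P (r * x)

  generated : Pred Carrier (c ⊔ ℓ) → Ideal R
  generated P = record
    { Member   = Generated P
    ; resp     = ≈-closed
    ; 0-closed = 0-member
    ; +-closed = sum
    ; *-closed = multiple
    }

  unitIdeal : Ideal R
  unitIdeal = record
    { Member   = λ _ → Lift (c ⊔ ℓ) ⊤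
    ; resp     = λ _ _ → lift tt
    ; 0-closed = lift tt
    ; +-closed = λ _ _ → lift tt
    ; *-closed = λ _ _ → lift tt
    }

  infixl 7 _*ᴵ_
  _*ᴵ_ : Ideal R → Ideal R → Ideal R
  I *ᴵ J = generated λ z →
    ∃[ x ] ∃[ y ] x ∈ Member I × y ∈ Member J × z ≈ x * y

  infixr 8 _^ᴵ_
  _^ᴵ_ : Ideal R → ℕ → Ideal R
  I ^ᴵ zero  = unitIdeal
  I ^ᴵ suc n = I *ᴵ (I ^ᴵ n)

module _ {c ℓ} (R : CommutativeRing c ℓ) where
  open CommutativeRing R
  open Algebra.Definitions _≈_ using (Invertible)

  principal : Carrier → Ideal R
  principal π = record
    { Member   = λ x → π ∣ x
    ; resp     = λ x≈y (u , uπ≈x) → u , trans uπ≈x x≈y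
    ; 0-closed = π ∣0
    ; +-closed = λ (u , uπ≈x) (v , vπ≈y) →
        u + v , trans (distribʳ π u v) (+-cong uπ≈x vπ≈y)
    ; *-closed = λ r → x∣ʳy⇒x∣ʳzy r
    }
    where
    open Algebra.Properties.Semiring.Divisibility semiring

  natural : ℕ → Carrier
  natural n = n ×ᴿ 1#
    where open Algebra.Properties.Semiring.Mult semiring using () renaming (_×_ to _×ᴿ_)

  power : Carrier → ℕ → Carrier
  power = _^_
    where open Algebra.Properties.Semiring.Exp semiring using (_^_)

  Associated : Carrier → Carrier → Set (c ⊔ ℓ)
  Associated x y = ∃[ u ] Invertible 1# _*_ u × x ≈ u * y

  record IsField : Set (c ⊔ ℓ) where
    field
      1≉0        : ¬ 1# ≈ 0#
      invertible : ∀ x → ¬ x ≈ 0# → Invertible 1# _*_ x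

infixl 7 _/_
_/_ : ∀ {c ℓ} (R : CommutativeRing c ℓ) → Ideal R → CommutativeRing c (c ⊔ ℓ)
_/_ {c} {ℓ} R I = record
  { Carrier = Carrier
  ; _≈_ = _∼_
  ; _+_ = _+_
  ; _*_ = _*_
  ; -_ = -_
  ; 0# = 0#
  ; 1# = 1#
  ; isCommutativeRing = record
    { isRing = record
      { +-isAbelianGroup = record
        { isGroup = record
          { isMonoid = record
            { isSemigroup = record
              { isMagma = record
                { isEquivalence = record
                  { refl = fromEq refl
                  ; sym = λ {x} {y} x∼y →
                      I.resp (⁻¹-anti-homo‿- x y) (neg-closed x∼y)
                  ; trans = λ {x} {y} {z} x∼y y∼z →
                      I.resp (telescope x y z) (I.+-closed x∼y y∼z)
                  }
                ; ∙-cong = λ {x} {y} {u} {v} x∼y u∼v →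
                    I.resp (+-difference x y u v) (I.+-closed x∼y u∼v)
                }
              ; assoc = λ x y z → fromEq (+-assoc x y z)
              }
            ; identity = (λ x → fromEq (+-identityˡ x))
                       , (λ x → fromEq (+-identityʳ x))
            }
          ; inverse = (λ x → fromEq (-‿inverseˡ x))
                    , (λ x → fromEq (-‿inverseʳ x))
          ; ⁻¹-cong = λ {x} {y} x∼y →
              I.resp (sym (-‿+-comm x (- y))) (neg-closed x∼y)
          }
        ; comm = λ x y → fromEq (+-comm x y)
        }
      ; *-cong = λ {x} {y} {u} {v} x∼y u∼v →
          I.resp (*-difference x y u v)
            (I.+-closed (I.*-closed x u∼v) (I.*-closed v x∼y))
      ; *-assoc = λ x y z → fromEq (*-assoc x y z)
      ; *-identity = (λ x → fromEq (*-identityˡ x))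
                   , (λ x → fromEq (*-identityʳ x))
      ; distrib = (λ x y z → fromEq (distribˡ x y z))
                , (λ x y z → fromEq (distribʳ x y z))
      }
    ; *-comm = λ x y → fromEq (*-comm x y)
    }
  }
  where
  open CommutativeRing R
  open Algebra.Properties.Ring ring
  open Algebra.Properties.CommutativeSemigroup +-commutativeSemigroup
    using (interchange)
  open import Relation.Binary.Reasoning.Setoid setoid
  module I = Ideal I

  _∼_ : Carrier → Carrier → Set (c ⊔ ℓ)
  x ∼ y = (x - y) ∈ Member I

  fromEq : ∀ {x y} → x ≈ y → x ∼ y
  fromEq x≈y = I.resp (sym (x≈y⇒x∙y⁻¹≈ε x≈y)) I.0-closed

  neg-closed : ∀ {x} → x ∈ Member I → (- x) ∈ Member I
  neg-closed {x} x∈I = I.resp (-1*x≈-x x) (I.*-closed (- 1#) x∈I)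

  telescope : ∀ x y z → (x - y) + (y - z) ≈ x - z
  telescope x y z = begin
    (x - y) + (y - z)   ≈⟨ +-assoc x (- y) (y - z) ⟩
    x + (- y + (y - z)) ≈⟨ +-congˡ (sym (+-assoc (- y) y (- z))) ⟩
    x + ((- y + y) - z) ≈⟨ +-congˡ (+-congʳ (-‿inverseˡ y)) ⟩
    x + (0# - z)        ≈⟨ +-congˡ (+-identityˡ (- z)) ⟩
    x - z               ∎

  +-difference : ∀ x y u v → (x - y) + (u - v) ≈ (x + u) - (y + v)
  +-difference x y u v = begin
    (x - y) + (u - v)     ≈⟨ interchange x (- y) u (- v) ⟩
    (x + u) + (- y + - v) ≈⟨ +-congˡ (-‿+-comm y v) ⟩
    (x + u) - (y + v)     ∎

  *-difference : ∀ x y u v → x * (u - v) + v * (x - y) ≈ x * u - y * v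
  *-difference x y u v = begin
    x * (u - v) + v * (x - y)
      ≈⟨ +-cong (x[y-z]≈xy-xz x u v)
                (trans (x[y-z]≈xy-xz v x y)
                       (+-cong (*-comm v x) (-‿cong (*-comm v y)))) ⟩
    (x * u - x * v) + (x * v - y * v)
      ≈⟨ telescope (x * u) (x * v) (y * v) ⟩
    x * u - y * v ∎

IsCosetRepresentatives : ∀ {c ℓ} (R : CommutativeRing c ℓ) (I : Ideal R) {n : ℕ} →
                         (Fin n → CommutativeRing.Carrier R) → Set (c ⊔ ℓ)
IsCosetRepresentatives R I a = Bijective _≡_ (CommutativeRing._≈_ (R / I)) a

record FiniteChainRing c ℓ : Set (lsuc (c ⊔ ℓ)) where
  field
    commutativeRing : CommutativeRing c ℓ
  open CommutativeRing commutativeRing public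
  field
    order     : ℕ
    hasOrder  : HasOrder setoid order
    π         : Carrier
  I : Ideal commutativeRing
  I = principal commutativeRing π
  field
    isLocal   : IsUniqueMaximal I

module _ {c ℓ} (G : AbelianGroup c ℓ) where
  open AbelianGroup G

  record Subset p : Set (c ⊔ ℓ ⊔ lsuc p) where
    field
      Elem  : Pred Carrier p
      resp  : ∀ {x y} → x ≈ y → Elem x → Elem y
      Elem? : Decidable Elem

open Subset using (Elem; Elem?)

module FiniteAbelianGroup
  {c ℓ} (G : AbelianGroup c ℓ) {N} (G≅N : HasOrder (AbelianGroup.setoid G) N)
  where
  open AbelianGroup G
  open FiniteSetoid setoid G≅N
  open Inverse G≅N using () renaming (from to element)
  module Σℕ = Algebra.Properties.CommutativeMonoid.Sum ℕ.+-0-commutativeMonoid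
  module Σℤ = Algebra.Properties.CommutativeMonoid.Sum ℤ.+-0-commutativeMonoid

  full : Subset G _
  full = record { Elem = λ _ → ⊤ ; resp = λ _ _ → tt ; Elem? = λ _ → yes tt }

  ｛_｝ : Carrier → Subset G ℓ
  ｛ g ｝ = record
    { Elem  = λ x → x ≈ g
    ; resp  = λ x≈y x≈g → trans (sym x≈y) x≈g
    ; Elem? = λ x → x ≈? g
    }

  infixl 6 _∖_
  _∖_ : ∀ {p q} → Subset G p → Subset G q → Subset G (p ⊔ q)
  A ∖ B = record
    { Elem  = λ x → x ∈ Elem A × x ∉ Elem B
    ; resp  = λ x≈y (x∈A , x∉B) →
        Subset.resp A x≈y x∈A , λ y∈B → x∉B (Subset.resp B (sym x≈y) y∈B)
    ; Elem? = λ x → Elem? A x ×-dec ¬? (Elem? B x)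
    }

  ⋃ : ∀ {n p q} {D : Pred (Fin n) q} → Decidable D → (Fin n → Subset G p) →
      Subset G (p ⊔ q)
  ⋃ {D = D} D? A = record
    { Elem  = λ x → ∃[ i ] i ∈ D × x ∈ Elem (A i)
    ; resp  = λ x≈y (i , i∈D , x∈A) → i , i∈D , Subset.resp (A i) x≈y x∈A
    ; Elem? = λ x → Fin.any? λ i → D? i ×-dec Elem? (A i) x
    }

  coset : ∀ {p} → Carrier → Subset G p → Subset G (c ⊔ ℓ ⊔ p)
  coset g A = record
    { Elem  = λ x → ∃[ h ] h ∈ Elem A × x ≈ g ∙ h
    ; resp  = λ x≈y (h , h∈A , x≈gh) → h , h∈A , trans (sym x≈y) x≈gh
    ; Elem? = λ x → any?
        (λ h≈k (h∈A , x≈gh) → Subset.resp A h≈k h∈A , trans x≈gh (∙-congˡ h≈k))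
        (λ h → Elem? A h ×-dec (x ≈? (g ∙ h)))
    }

  ∣_∣ : ∀ {p} → Subset G p → ℕ
  ∣ A ∣ = Σℕ.sum λ i → if does (Elem? A (element i)) then 1 else 0

  -- An element ∑_g f(g) g of the group ring is its coefficient function f.
  ℤ[G] : Set c
  ℤ[G] = Carrier → ℤ

  infix  4 _≋_
  infixl 6 _⊕_
  infixr 7 _·_
  infixl 7 _⊛_

  _≋_ : ℤ[G] → ℤ[G] → Set c
  f ≋ g = ∀ x → f x ≡ g x

  _⊕_ : ℤ[G] → ℤ[G] → ℤ[G]
  (f ⊕ g) x = f x ℤ.+ g x

  _·_ : ℤ → ℤ[G] → ℤ[G]
  (a · f) x = a ℤ.* f x

  _⊛_ : ℤ[G] → ℤ[G] → ℤ[G]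
  (f ⊛ g) x = Σℤ.sum λ i → f (element i) ℤ.* g (element i ⁻¹ ∙ x)

  ∑ : ∀ {m} → (Fin m → ℤ[G]) → ℤ[G]
  ∑ f x = Σℤ.sum λ l → f l x

  ⟦_⟧ : ∀ {p} → Subset G p → ℤ[G]
  ⟦ A ⟧ x = if does (Elem? A x) then 1ℤ else 0ℤ

  δ : ∀ {m} → Fin m → Fin m → ℤ
  δ i j = if does (i Fin.≟ j) then 1ℤ else 0ℤ

  -- lam stands for λ, which is reserved; the parameters λ, μ, t are allowed
  -- to be arbitrary integers.
  record HasParameters {p} (m n k : ℕ) (lam μ t : ℤ)
    (S : Fin m → Fin m → Subset G p) : Set (c ⊔ ℓ ⊔ p) where
    field
      order≡n    : N ≡ n
      ε∉diagonal : ∀ i → ε ∉ Elem (S i i)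
      row-sum    : ∀ i → Σℕ.sum (λ j → ∣ S i j ∣) ≡ k
      column-sum : ∀ i → Σℕ.sum (λ j → ∣ S j i ∣) ≡ k
      product    : ∀ i j →
        let β = lam ℤ.- μ
            γ = t ℤ.- μ
        in
        ∑ (λ l → ⟦ S l j ⟧ ⊛ ⟦ S i l ⟧) ≋
          μ · ⟦ full ⟧ ⊕ β · ⟦ S i j ⟧ ⊕ (δ i j ℤ.* γ) · ⟦ ｛ ε ｝ ⟧

  IsPartialSumFamily : ∀ {p m} → (Fin m → Fin m → Subset G p) → Set (c ⊔ ℓ ⊔ p)
  IsPartialSumFamily {m = m} S =
    ∃[ n ] ∃[ k ] ∃[ lam ] ∃[ μ ] ∃[ t ] HasParameters m n k lam μ t S

-- a enumerates J, so that a i is the element with label a_{i+1}; index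
-- zero of label is a₀ = ∞.
module Construction
  {c ℓ} (𝓡 : FiniteChainRing c ℓ) {q : ℕ} (a : Fin q → FiniteChainRing.Carrier 𝓡)
  where
  open FiniteChainRing 𝓡 hiding (zero)

  G : AbelianGroup c ℓ
  G = DirectProduct.abelianGroup +-abelianGroup +-abelianGroup

  G≅ : HasOrder (AbelianGroup.setoid G) (order ℕ.* order)
  G≅ = inverse (hasOrder ×-inverse hasOrder)
         (inverse Pointwise-≡↔≡ (inverse-sym Fin.*↔×))

  open AbelianGroup G public using () renaming (Carrier to |G|; ε to 0ᴳ; _-_ to _-ᴳ_)
  open FiniteAbelianGroup G G≅ public
  open FiniteSetoid setoid hasOrder using (any?)
  open FiniteSetoid (AbelianGroup.setoid G) G≅ using () renaming (_≈?_ to _≈ᴳ?_)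

  data Slope : Set c where
    ∞      : Slope
    finite : Carrier → Slope

  point : Slope → Carrier → |G|
  point ∞          x = 0# , x
  point (finite b) x = x , b * x

  L : Slope → Subset G (c ⊔ ℓ)
  L b = record
    { Elem  = λ g → ∃[ x ] g ≈ᴳ point b x
    ; resp  = λ g≈h (x , g≈) → x , Gm.trans (Gm.sym g≈h) g≈
    ; Elem? = λ g → any? (λ x≈y g≈ → Gm.trans g≈ (point-cong b x≈y))
                         (λ x → g ≈ᴳ? point b x)
    }
    where
    module Gm = AbelianGroup G
    open Gm using () renaming (_≈_ to _≈ᴳ_)

    point-cong : ∀ b {x y} → x ≈ y → point b x ≈ᴳ point b y
    point-cong ∞          x≈y = refl , x≈y
    point-cong (finite b) x≈y = x≈y , *-congˡ x≈y

  label : Fin (suc q) → Slope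
  label zero    = ∞
  label (suc i) = finite (a i)

  D[_,_] : ℕ → ℕ → Pred (Fin (suc q)) _
  D[ i , j ] x = i ≤ toℕ x × toℕ x ≤ j

  D[_,_]? : ∀ i j → Decidable D[ i , j ]
  D[ i , j ]? x = (i ℕ.≤? toℕ x) ×-dec (toℕ x ℕ.≤? j)

  module _ {w : ℕ} (1≤w : 1 ≤ w) (w≤q : w ≤ q) where

    first-bound : ∀ {k} → k ≤ q ∸ w ℕ.+ 1 → k < suc q
    first-bound {k} k≤ = s≤s (begin
      k              ≤⟨ k≤ ⟩
      q ∸ w ℕ.+ 1    ≤⟨ ℕ.+-monoʳ-≤ (q ∸ w) 1≤w ⟩
      q ∸ w ℕ.+ w    ≡⟨ ℕ.m∸n+n≡m w≤q ⟩
      q              ∎)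
      where open ℕ.≤-Reasoning

    last-bound : ∀ {k} → k ≤ q ∸ w ℕ.+ 1 → w ℕ.+ k ∸ 1 < suc q
    last-bound {k} k≤ = s≤s (begin
      w ℕ.+ k ∸ 1                ≤⟨ ℕ.∸-monoˡ-≤ 1 (ℕ.+-monoʳ-≤ w k≤) ⟩
      w ℕ.+ (q ∸ w ℕ.+ 1) ∸ 1    ≡⟨ ≡.cong (_∸ 1) (≡.sym (ℕ.+-assoc w (q ∸ w) 1)) ⟩
      w ℕ.+ (q ∸ w) ℕ.+ 1 ∸ 1    ≡⟨ ℕ.m+n∸n≡m (w ℕ.+ (q ∸ w)) 1 ⟩
      w ℕ.+ (q ∸ w)              ≡⟨ ℕ.m+[n∸m]≡n w≤q ⟩
      q                          ∎)
      where open ℕ.≤-Reasoning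

    module Indices {z₁ : ℕ} (k : Fin (suc z₁) → ℕ)
      (k-bounded : ∀ i → k i ≤ q ∸ w ℕ.+ 1) where

      -- Only the values at i ≢ j matter.
      b : Fin (suc z₁) → Fin (suc z₁) → Slope
      b i j with i Fin.<? j
      ... | yes _ = label (fromℕ< (first-bound (k-bounded i)))
      ... | no  _ = label (fromℕ< (last-bound (k-bounded i)))

    -- T i j enumerates T_{i,j} without repetition; the values T i i are
    -- unconstrained and unused.
    record Choice (z₁ z₂ : ℕ) : Set (c ⊔ ℓ) where
      field
        k            : Fin (suc z₁) → ℕ
        k-increasing : ∀ {i j} → i Fin.< j → k i < k j
        k-bounded    : ∀ i → k i ≤ q ∸ w ℕ.+ 1
      open Indices k k-bounded public
      field
        T            : Fin (suc z₁) → Fin (suc z₁) → Fin z₂ → |G|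
        T-distinct   : ∀ {i j} → i ≢ j → ∀ {u v} → u ≢ v →
                       (T i j u -ᴳ T i j v) ∉ Elem (L (b i j))

      S : Fin (suc z₁) → Fin (suc z₁) → Subset G (c ⊔ ℓ)
      S i j with i Fin.≟ j
      ... | yes _ = ⋃ D[ k i , w ℕ.+ k i ∸ 1 ]? (L ∘ label) ∖ ｛ 0ᴳ ｝
      ... | no  _ = ⋃ {D = λ _ → ⊤} (λ _ → yes tt) (λ u → coset (T i j u) (L (b i j)))

{-# OPTIONS --safe #-}

-- Elements a i ≠ a j of the system of representatives differ by a unit, so G
-- is the direct sum of any two distinct lines L, L′.  In ℤ[G] this reads
-- L L′ = G, while L L = |R| L.  Hence
--   S_ii S_ii = (w² - w) G + (|R| - 2w) S_ii + (|R| w - w²) 0_G,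
-- and, as b_ij lies in A_i but not in A_j,
--   S_ij S_ii + S_jj S_ij = (2w - 1) z₂ G + (|R| - 2w) S_ij.
-- All other products S_lj S_il equal z₂² G, because b_lj ∈ A_l ∌ b_il.  The
-- diagonal equations, evaluated at 0_G and at a point inside and a point outside
-- S_ii, determine λ, μ, t; the off-diagonal ones then hold if and only if
-- (z₂ - w)(z₂ - w + 1) = 0.  Finally |R| = pˢᵈ, because every element of R has
-- a unique π-adic expansion with s digits among the a i.
module Submission where

open import Defs
open import Level using (Level; _⊔_)
open import Algebra.Bundles using (AbelianGroup; CommutativeRing)
import Algebra.Properties.AbelianGroup
import Algebra.Properties.CommutativeSemigroup
import Algebra.Properties.Ring
import Algebra.Properties.Semiring.Divisibility
import Algebra.Properties.Semiring.Exp
import Algebra.Properties.Semiring.Sum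
import Algebra.Solver.Ring.NaturalCoefficients.Default as SemiringSolver
open import Data.Bool.Base using (if_then_else_)
open import Data.Bool.Properties using (if-float)
open import Data.Fin.Base as Fin using (Fin; zero; suc; toℕ; remQuot; combine)
import Data.Fin.Properties as Fin
open import Data.Integer.Base using (ℤ; +_; 0ℤ; 1ℤ) renaming (_+_ to _+ℤ_; _*_ to _*ℤ_; _-_ to _-ℤ_)
import Data.Integer.Base as ℤ
import Data.Integer.Properties as ℤ
import Data.Integer.Tactic.RingSolver as ℤSolver
open import Data.Nat.Base as ℕ using (ℕ; zero; suc)
open import Data.Nat.Primality using (Prime; prime⇒nonTrivial)
import Data.Nat.Properties as ℕ
import Data.Nat.Tactic.RingSolver as ℕSolver
open import Data.Product.Base using (_×_; _,_; ∃-syntax; proj₁; proj₂)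
open import Data.Sum.Base using (_⊎_; inj₁; inj₂)
open import Data.Unit.Base using (⊤; tt)
open import Function.Base using (_∘_)
open import Function.Bundles using (Inverse; Equivalence; _⇔_; mk⇔; mk↔ₛ′)
open import Function.Definitions using (Injective)
open import Relation.Binary.PropositionalEquality as ≡ using (_≡_; _≢_; module ≡-Reasoning)
open import Relation.Nullary using (¬_; Dec; yes; no; does)
open import Relation.Nullary.Decidable using (does-⇔; dec-true; dec-false; _×-dec_)
open import Relation.Nullary.Negation using (contradiction)
open import Relation.Unary using (Pred; Decidable)

open Algebra.Properties.Semiring.Sum ℤ.+-*-semiring
  using (sum-cong-≗; ∑-comm; ∑-distrib-+; *-distribˡ-sum; *-distribʳ-sum; sum-permute; sum-replicate-zero)
  renaming (sum to sumℤ)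
open Algebra.Properties.Semiring.Sum ℕ.+-*-semiring using () renaming (sum to sumℕ)

private variable
  c ℓ p q : Level
  P : Set p
  Q : Set q

-- In the off-diagonal sums the coefficient |R| - 2w of `S i j` already equals the λ - μ forced by
-- the diagonal, so both sides can differ only in the coefficient of G. Comparing these leaves z₂² -
-- (2w - 1) z₂ + w² - w, which is the product in the criterion. For w = 1 its second root is z₂ = 0,
-- which 1 ≤ z₂ excludes. The integers λ, μ, t are existentially quantified in a partial sum family,
-- so necessity has to recover them before anything can be compared. Here z₁ ≥ 1 matters: a second
-- index supplies both a line outside A_i and an off-diagonal equation. The geometry of lines takes
-- from the representatives only `DifferencesInvertible`, which follows from R/I being a field and π
-- being nilpotent. The π-adic expansions serve to turn |R| into pˢᵈ.

DifferencesInvertible : (R : CommutativeRing c ℓ) {q : ℕ} → (Fin q → CommutativeRing.Carrier R) → Set _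
DifferencesInvertible R a = ∀ {i j} → i ≢ j → ∃[ y ] (a i - a j) * y ≈ 1#
  where open CommutativeRing R

-- Nilpotent principal ideals, units and π-adic expansions.

module NilpotentPrincipal (R : CommutativeRing c ℓ) (π : CommutativeRing.Carrier R) where
  open CommutativeRing R hiding (zero)
  open Algebra.Properties.Ring ring using (+-cancelˡ)
  open Algebra.Properties.Semiring.Divisibility semiring using (_∣_; _,_)
  open SemiringSolver commutativeSemiring using (solve; _:=_; _:+_; _:*_)
  open import Relation.Binary.Reasoning.Setoid setoid

  private
    I = principal R π
    π^ = power R π

  power∈ : ∀ n → Ideal.Member (I ^ᴵ n) (π^ n)
  power∈ zero    = _
  power∈ (suc n) = generator (π , π^ n , (1# , *-identityˡ π) , power∈ n , refl)

  -- Membership in a product of ideals is generated inductively, and the multiples of πⁿ are closed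
  -- under every constructor.
  power∣ : ∀ n {x} → Ideal.Member (I ^ᴵ n) x → π^ n ∣ x
  power∣ zero    {x} _ = x , *-identityʳ x
  power∣ (suc n) (generator (x , y , (u , uπ≈x) , y∈ , z≈xy)) =
    let v , vπⁿ≈y = power∣ n y∈ in
    u * v , (begin
      u * v * (π * π^ n)   ≈⟨ solve 4 (λ u v a b → u :* v :* (a :* b) := u :* a :* (v :* b)) refl u v π (π^ n) ⟩
      u * π * (v * π^ n)   ≈⟨ *-cong uπ≈x vπⁿ≈y ⟩
      x * y                ≈⟨ z≈xy ⟨
      _                    ∎)
  power∣ (suc n) (≈-closed x≈y x∈) = Ideal.resp (principal R (π^ (suc n))) x≈y (power∣ (suc n) x∈)
  power∣ (suc n) 0-member          = Ideal.0-closed (principal R (π^ (suc n)))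
  power∣ (suc n) (sum x∈ y∈)       = Ideal.+-closed (principal R (π^ (suc n))) (power∣ (suc n) x∈) (power∣ (suc n) y∈)
  power∣ (suc n) (multiple r x∈)   = Ideal.*-closed (principal R (π^ (suc n))) r (power∣ (suc n) x∈)

  IsZero⇒power≈0 : ∀ n → IsZero (I ^ᴵ n) → π^ n ≈ 0#
  IsZero⇒power≈0 n zero! = zero! (power∈ n)

  power≈0⇒IsZero : ∀ n → π^ n ≈ 0# → IsZero (I ^ᴵ n)
  power≈0⇒IsZero n πⁿ≈0 x∈ = let u , uπⁿ≈x = power∣ n x∈ in
    trans (sym uπⁿ≈x) (trans (*-congˡ πⁿ≈0) (zeroʳ u))

  -- Multiply 1 = x y + π z by 1 = x y′ + πⁿ z′.
  unit-mod-power : ∀ {x y z} → x * y + π * z ≈ 1# →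
                   ∀ n → ∃[ y′ ] ∃[ z′ ] x * y′ + π^ n * z′ ≈ 1#
  unit-mod-power {x} xy+πz≈1 zero = 0# , 1# , (begin
    x * 0# + 1# * 1#  ≈⟨ +-cong (zeroʳ x) (*-identityˡ 1#) ⟩
    0# + 1#           ≈⟨ +-identityˡ 1# ⟩
    1#                ∎)
  unit-mod-power {x} {y} {z} xy+πz≈1 (suc n) =
    let y′ , z′ , eq = unit-mod-power xy+πz≈1 n in
    y * (x * y′) + y * (π^ n * z′) + π * z * y′ , z * z′ , (begin
      x * (y * (x * y′) + y * (π^ n * z′) + π * z * y′) + π * π^ n * (z * z′)
        ≈⟨ solve 7 (λ x y z π πⁿ y′ z′ →
             x :* (y :* (x :* y′) :+ y :* (πⁿ :* z′) :+ π :* z :* y′) :+ π :* πⁿ :* (z :* z′)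
             := (x :* y :+ π :* z) :* (x :* y′ :+ πⁿ :* z′))
             refl x y z π (π^ n) y′ z′ ⟩
      (x * y + π * z) * (x * y′ + π^ n * z′)
        ≈⟨ *-cong xy+πz≈1 eq ⟩
      1# * 1#
        ≈⟨ *-identityˡ 1# ⟩
      1# ∎)

  module _ {s} (πˢ≈0 : π^ s ≈ 0#) (R/I-field : IsField (R / I)) where

    -- An inverse modulo I is a Bézout relation between x and π. Raising the modulus from π to πˢ =
    -- 0 makes the second term disappear.
    ∉⇒invertible : ∀ {x} → ¬ Ideal.Member I x → ∃[ y ] x * y ≈ 1#
    ∉⇒invertible {x} x∉I =
      let y , yx∼1 , _ = IsField.invertible R/I-field x (λ x∼0 → x∉I (Ideal.resp I (x-0 x) x∼0))
          u , uπ≈yx-1 = yx∼1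
          y′ , z′ , eq = unit-mod-power {x} {y} { - u} (bézout uπ≈yx-1) s
      in y′ , (begin
        x * y′               ≈⟨ +-identityʳ _ ⟨
        x * y′ + 0#          ≈⟨ +-congˡ (trans (*-congʳ πˢ≈0) (zeroˡ z′)) ⟨
        x * y′ + π^ s * z′   ≈⟨ eq ⟩
        1#                   ∎)
      where
      open Algebra.Properties.Ring ring using (-‿distribʳ-*; -0#≈0#; xyx⁻¹≈y; //-rightDividesˡ)
      x-0 : ∀ x → x - 0# ≈ x
      x-0 x = trans (+-congˡ -0#≈0#) (+-identityʳ x)
      bézout : ∀ {y u} → u * π ≈ y * x - 1# → x * y + π * (- u) ≈ 1#
      bézout {y} {u} eq = begin
        x * y + π * (- u)           ≈⟨ +-cong (*-comm x y) (sym (-‿distribʳ-* π u)) ⟩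
        y * x - π * u               ≈⟨ +-cong (sym (//-rightDividesˡ 1# (y * x))) (-‿cong (trans (*-comm π u) eq)) ⟩
        (y * x - 1#) + 1# - (y * x - 1#)   ≈⟨ xyx⁻¹≈y _ _ ⟩
        1#                          ∎

    module _ {q} {a : Fin q → Carrier} (a-reps : IsCosetRepresentatives R I a) where
      open Algebra.Properties.Ring ring using (//-rightDividesˡ; +-identityˡ-unique)
      open Algebra.Properties.Semiring.Exp semiring using (^-homo-*)

      difference-invertible : DifferencesInvertible R a
      difference-invertible i≢j = ∉⇒invertible (λ aᵢ∼aⱼ → i≢j (proj₁ a-reps aᵢ∼aⱼ))

      -- The index encodes the first n digits of a π-adic expansion.
      expansion : ∀ n → Fin (q ℕ.^ n) → Carrier
      expansion zero    _ = 0#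
      expansion (suc n) i = a (proj₁ (remQuot {q} (q ℕ.^ n) i)) + π * expansion n (proj₂ (remQuot {q} (q ℕ.^ n) i))

      -- The leading digit is the representative of x modulo I. Membership gives u π = a c - x, so
      -- the expansion continues with the quotient -u. For n = s the remainder πⁿ y vanishes.
      expansion-surjective : ∀ n x → ∃[ i ] ∃[ y ] x ≈ expansion n i + π^ n * y
      expansion-surjective zero x = zero , x , sym (trans (+-identityˡ _) (*-identityˡ x))
      expansion-surjective (suc n) x
        with c , aᶜ∼x ← proj₂ a-reps x
        with u , uπ≈aᶜ-x ← aᶜ∼x ≡.refl
        with j , y , -u≈ ← expansion-surjective n (- u)
        = combine c j , y , (begin
          x                                     ≈⟨ x≈ ⟩
          a c + π * (- u)                       ≈⟨ +-congˡ (*-congˡ -u≈) ⟩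
          a c + π * (expansion n j + π^ n * y)
            ≈⟨ solve 5 (λ b π e πⁿ y → b :+ π :* (e :+ πⁿ :* y) := (b :+ π :* e) :+ π :* πⁿ :* y)
                 refl (a c) π (expansion n j) (π^ n) y ⟩
          (a c + π * expansion n j) + π * π^ n * y
            ≡⟨ ≡.cong (λ (c , j) → (a c + π * expansion n j) + π * π^ n * y)
                 (≡.sym (Fin.remQuot-combine c j)) ⟩
          expansion (suc n) (combine c j) + π * π^ n * y ∎)
        where
        open Algebra.Properties.Ring ring using (-‿distribʳ-*; ⁻¹-anti-homo‿-)
        x≈ : x ≈ a c + π * (- u)
        x≈ = begin
          x                    ≈⟨ //-rightDividesˡ (a c) x ⟨
          x - a c + a c        ≈⟨ +-comm _ _ ⟩
          a c + (x - a c)      ≈⟨ +-congˡ (⁻¹-anti-homo‿- (a c) x) ⟨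
          a c - (a c - x)      ≈⟨ +-congˡ (-‿cong (trans (*-comm π u) uπ≈aᶜ-x)) ⟨
          a c - π * u          ≈⟨ +-congˡ (-‿distribʳ-* π u) ⟩
          a c + π * (- u)      ∎

      module _ {s′} (s≡ : s ≡ suc s′) (πˢ⁻¹≉0 : ¬ π^ s′ ≈ 0#) where

        -- If the leading digits differ, then e = a c - a c′ is invertible and
        -- multiplying by πⁿ e⁻¹ leaves πˢ⁻¹ = 0.
        leading-digit : ∀ {m n} → m ℕ.+ n ≡ s′ → ∀ {c c′ x x′} →
                        π^ m * (a c + π * x) ≈ π^ m * (a c′ + π * x′) → c ≡ c′
        leading-digit {m} {n} m+n≡s′ {c} {c′} {x} {x′} eq with c Fin.≟ c′
        ... | yes c≡c′ = c≡c′
        ... | no  c≢c′ = contradiction (+-identityˡ-unique (π^ s′) (π^ s′ * (y * a c′)) (begin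
          π^ s′ + π^ s′ * (y * a c′)
            ≈⟨ +-congʳ (*-identityʳ _) ⟨
          π^ s′ * 1# + π^ s′ * (y * a c′)
            ≈⟨ +-congʳ (*-congˡ ey≈1) ⟨
          π^ s′ * (e * y) + π^ s′ * (y * a c′)
            ≈⟨ solve 4 (λ p e y a → p :* (e :* y) :+ p :* (y :* a) := p :* (y :* (e :+ a))) refl (π^ s′) e y (a c′) ⟩
          π^ s′ * (y * (e + a c′))
            ≈⟨ *-congˡ (*-congˡ (//-rightDividesˡ (a c′) (a c))) ⟩
          π^ s′ * (y * a c)
            ≈⟨ extend ⟨
          (π^ n * y) * (π^ m * (a c + π * x))
            ≈⟨ *-congˡ eq ⟩
          (π^ n * y) * (π^ m * (a c′ + π * x′))
            ≈⟨ extend ⟩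
          π^ s′ * (y * a c′) ∎)) πˢ⁻¹≉0
          where
          e = a c - a c′
          y = proj₁ (difference-invertible c≢c′)
          ey≈1 = proj₂ (difference-invertible c≢c′)
          -- The tail `π * x` acquires the factor πˢ = 0, so only the leading digit survives the
          -- multiplication.
          extend : ∀ {a x} → (π^ n * y) * (π^ m * (a + π * x)) ≈ π^ s′ * (y * a)
          extend {a} {x} = begin
            (π^ n * y) * (π^ m * (a + π * x))
              ≈⟨ solve 6 (λ πⁿ πᵐ y a π x → (πⁿ :* y) :* (πᵐ :* (a :+ π :* x)) :=
                   (πᵐ :* πⁿ) :* (y :* a) :+ (π :* (πᵐ :* πⁿ)) :* (y :* x)) refl (π^ n) (π^ m) y a π x ⟩
            (π^ m * π^ n) * (y * a) + (π * (π^ m * π^ n)) * (y * x)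
              ≈⟨ +-cong (*-congʳ πᵐπⁿ) (*-congʳ (*-congˡ πᵐπⁿ)) ⟩
            π^ s′ * (y * a) + π^ (suc s′) * (y * x)
              ≈⟨ +-congˡ (trans (*-congʳ (≡.subst (λ k → π^ k ≈ 0#) s≡ πˢ≈0)) (zeroˡ _)) ⟩
            π^ s′ * (y * a) + 0#
              ≈⟨ +-identityʳ _ ⟩
            π^ s′ * (y * a) ∎
            where
            πᵐπⁿ : π^ m * π^ n ≈ π^ s′
            πᵐπⁿ = trans (sym (^-homo-* π m n)) (reflexive (≡.cong π^ m+n≡s′))

        -- Since π is nilpotent, it cannot be cancelled after a digit is removed. The induction
        -- therefore carries a factor πᵐ with m + n = s, and each step moves one π from the tail
        -- into that factor.
        expansion-injective : ∀ m n → m ℕ.+ n ≡ s → ∀ {i j} →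
                              π^ m * expansion n i ≈ π^ m * expansion n j → i ≡ j
        expansion-injective m zero    m+n≡s {zero} {zero} _ = ≡.refl
        expansion-injective m (suc n) m+n≡s {i} {j} eq =
          ≡.trans (≡.sym (Fin.combine-remQuot {q} (q ℕ.^ n) i))
            (≡.trans (≡.cong₂ combine c≡c′ tails≡) (Fin.combine-remQuot {q} (q ℕ.^ n) j))
          where
          m+1+n≡ : suc (m ℕ.+ n) ≡ s
          m+1+n≡ = ≡.trans (≡.sym (ℕ.+-suc m n)) m+n≡s

          i₀ i₁ : _
          i₀ = proj₁ (remQuot {q} (q ℕ.^ n) i)
          i₁ = proj₁ (remQuot {q} (q ℕ.^ n) j)

          c≡c′ : i₀ ≡ i₁
          c≡c′ = leading-digit {m} {n} (ℕ.suc-injective (≡.trans m+1+n≡ s≡)) eq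

          tails≡ : proj₂ (remQuot {q} (q ℕ.^ n) i) ≡ proj₂ (remQuot {q} (q ℕ.^ n) j)
          tails≡ = expansion-injective (suc m) n m+1+n≡
            (trans shift (trans (+-cancelˡ (π^ m * a i₁) _ _ (begin
              π^ m * a i₁ + π^ m * (π * expansion n _) ≈⟨ distribˡ _ _ _ ⟨
              π^ m * (a i₁ + π * expansion n _)        ≡⟨ ≡.cong (λ c → π^ m * (a c + π * expansion n _)) c≡c′ ⟨
              π^ m * (a i₀ + π * expansion n _)        ≈⟨ eq ⟩
              π^ m * (a i₁ + π * expansion n _)        ≈⟨ distribˡ _ _ _ ⟩
              π^ m * a i₁ + π^ m * (π * expansion n _) ∎)) (sym shift)))
            where
            shift : ∀ {x} → π * π^ m * x ≈ π^ m * (π * x)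
            shift {x} = solve 3 (λ π p x → π :* p :* x := p :* (π :* x)) refl π (π^ m) x

        -- Existence of expansions injects R into the digit strings, and their uniqueness injects
        -- the digit strings into R.
        order≡qˢ : ∀ {N} → HasOrder setoid N → N ≡ q ℕ.^ s
        order≡qˢ N≅ = Fin.cantor-schröder-bernstein digits-injective to∘expansion-injective
          where
          open Inverse N≅ using (to; from; to-cong; strictlyInverseˡ; strictlyInverseʳ)
          digits : _ → _
          digits i = proj₁ (expansion-surjective s (from i))

          from≈ : ∀ i → from i ≈ expansion s (digits i)
          from≈ i with _ , y , eq ← expansion-surjective s (from i) =
            trans eq (trans (+-congˡ (trans (*-congʳ πˢ≈0) (zeroˡ y))) (+-identityʳ _))

          digits-injective : Injective _≡_ _≡_ digits
          digits-injective {i} {j} eq = ≡.trans (≡.sym (strictlyInverseˡ i)) (≡.trans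
            (to-cong (trans (from≈ i) (trans (reflexive (≡.cong (expansion s) eq)) (sym (from≈ j)))))
            (strictlyInverseˡ j))

          to∘expansion-injective : Injective _≡_ _≡_ (λ i → to (expansion s i))
          to∘expansion-injective {i} {j} eq = expansion-injective 0 s ≡.refl (*-congˡ
            (trans (sym (strictlyInverseʳ _)) (trans (Inverse.from-cong N≅ eq) (strictlyInverseʳ _))))

-- Indicators and finite integer sums.

-- Both `⟦ A ⟧ x` and `δ i j` unfold to such an indicator, so the rules below apply to group ring
-- coefficients directly.
𝟙 : Dec P → ℤ
𝟙 P? = if does P? then 1ℤ else 0ℤ

𝟙-cong : P ⇔ Q → (P? : Dec P) (Q? : Dec Q) → 𝟙 P? ≡ 𝟙 Q?
𝟙-cong P⇔Q P? Q? = ≡.cong (if_then 1ℤ else 0ℤ) (does-⇔ P⇔Q P? Q?)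

𝟙-true : (P? : Dec P) → P → 𝟙 P? ≡ 1ℤ
𝟙-true P? p = ≡.cong (if_then 1ℤ else 0ℤ) (dec-true P? p)

𝟙-false : (P? : Dec P) → ¬ P → 𝟙 P? ≡ 0ℤ
𝟙-false P? ¬p = ≡.cong (if_then 1ℤ else 0ℤ) (dec-false P? ¬p)

𝟙-idem : (P? : Dec P) → 𝟙 P? *ℤ 𝟙 P? ≡ 𝟙 P?
𝟙-idem (yes _) = ≡.refl
𝟙-idem (no _)  = ≡.refl

𝟙-× : (P? : Dec P) (Q? : Dec Q) → 𝟙 (P? ×-dec Q?) ≡ 𝟙 P? *ℤ 𝟙 Q?
𝟙-× (yes _) Q? = ≡.sym (ℤ.*-identityˡ (𝟙 Q?))
𝟙-× (no _)  Q? = ≡.sym (ℤ.*-zeroˡ (𝟙 Q?))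

sum-zero : ∀ {n} (f : Fin n → ℤ) → (∀ i → f i ≡ 0ℤ) → sumℤ f ≡ 0ℤ
sum-zero {n} f f≡0 = ≡.trans (sum-cong-≗ f≡0) (sum-replicate-zero n)

pos-sum : ∀ {n} (f : Fin n → ℕ) → + sumℕ f ≡ sumℤ (λ i → + f i)
pos-sum {zero}  f = ≡.refl
pos-sum {suc n} f = ≡.trans (ℤ.pos-+ (f zero) _) (≡.cong (+ f zero +ℤ_) (pos-sum (λ i → f (suc i))))

sum-const : ∀ n x → sumℤ {n} (λ _ → x) ≡ + n *ℤ x
sum-const zero    x = ≡.sym (ℤ.*-zeroˡ x)
sum-const (suc n) x = ≡.trans (≡.cong (x +ℤ_) (sum-const n x)) (≡.sym (ℤ.suc-* (+ n) x))

sum-select : ∀ {n} (k : Fin n) f → sumℤ (λ i → 𝟙 (i Fin.≟ k) *ℤ f i) ≡ f k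
sum-select zero f = ≡.trans
  (≡.cong₂ _+ℤ_ (ℤ.*-identityˡ (f zero)) (sum-zero _ (λ i → ℤ.*-zeroˡ (f (suc i)))))
  (ℤ.+-identityʳ (f zero))
sum-select (suc k) f = ≡.trans
  (≡.cong₂ _+ℤ_ (ℤ.*-zeroˡ (f zero)) (sum-select k (λ i → f (suc i))))
  (ℤ.+-identityˡ (f (suc k)))

sum-𝟙-unique : ∀ {n} {P : Pred (Fin n) p} (P? : Decidable P) k → P k → (∀ {i} → P i → i ≡ k) →
               ∀ f → sumℤ (λ i → 𝟙 (P? i) *ℤ f i) ≡ f k
sum-𝟙-unique {P = P} P? k Pk unique f = ≡.trans
  (sum-cong-≗ λ i → ≡.cong (_*ℤ f i) (𝟙-cong (mk⇔ unique (λ i≡k → ≡.subst P (≡.sym i≡k) Pk)) (P? i) (i Fin.≟ k)))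
  (sum-select k f)

-- Converts a disjoint union, whose membership is decided by `Fin.any?`, into a sum of indicators.
sum-𝟙 : ∀ {n} {P : Pred (Fin n) p} (P? : Decidable P) → (∀ {i j} → P i → P j → i ≡ j) →
        sumℤ (λ i → 𝟙 (P? i)) ≡ 𝟙 (Fin.any? P?)
sum-𝟙 P? unique with Fin.any? P?
... | yes (k , Pk) = ≡.trans (sum-cong-≗ λ i → ≡.sym (ℤ.*-identityʳ (𝟙 (P? i))))
                       (sum-𝟙-unique P? k Pk (λ Pi → unique Pi Pk) (λ _ → 1ℤ))
... | no ¬P        = sum-zero _ λ i → 𝟙-false (P? i) (λ Pi → ¬P (i , Pi))

-- Meant for the off-diagonal equations, where only l = i and l = j involve a diagonal block.
-- Writing the exceptions as corrections to a constant avoids the count n - 2.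
sum-two-exceptions : ∀ {n} (f : Fin n → ℤ) {i j} y → i ≢ j → (∀ {l} → l ≢ i → l ≢ j → f l ≡ y) →
                     sumℤ f ≡ + n *ℤ y +ℤ (f i -ℤ y) +ℤ (f j -ℤ y)
sum-two-exceptions {n} f {i} {j} y i≢j generic = begin
  sumℤ f
    ≡⟨ sum-cong-≗ split ⟩
  sumℤ (λ l → (y +ℤ 𝟙 (l Fin.≟ i) *ℤ (f l -ℤ y)) +ℤ 𝟙 (l Fin.≟ j) *ℤ (f l -ℤ y))
    ≡⟨ ∑-distrib-+ (λ l → y +ℤ 𝟙 (l Fin.≟ i) *ℤ (f l -ℤ y)) (λ l → 𝟙 (l Fin.≟ j) *ℤ (f l -ℤ y)) ⟩
  sumℤ (λ l → y +ℤ 𝟙 (l Fin.≟ i) *ℤ (f l -ℤ y)) +ℤ sumℤ (λ l → 𝟙 (l Fin.≟ j) *ℤ (f l -ℤ y))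
    ≡⟨ ≡.cong₂ _+ℤ_
         (≡.trans (∑-distrib-+ (λ _ → y) (λ l → 𝟙 (l Fin.≟ i) *ℤ (f l -ℤ y)))
           (≡.cong₂ _+ℤ_ (sum-const n y) (sum-select i (λ l → f l -ℤ y))))
         (sum-select j (λ l → f l -ℤ y)) ⟩
  + n *ℤ y +ℤ (f i -ℤ y) +ℤ (f j -ℤ y) ∎
  where
  open ≡-Reasoning
  first : ∀ x y → x ≡ (y +ℤ 1ℤ *ℤ (x -ℤ y)) +ℤ 0ℤ *ℤ (x -ℤ y)
  first = ℤSolver.solve-∀
  second : ∀ x y → x ≡ (y +ℤ 0ℤ *ℤ (x -ℤ y)) +ℤ 1ℤ *ℤ (x -ℤ y)
  second = ℤSolver.solve-∀
  neither : ∀ x y → y ≡ (y +ℤ 0ℤ *ℤ (x -ℤ y)) +ℤ 0ℤ *ℤ (x -ℤ y)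
  neither = ℤSolver.solve-∀
  split : ∀ l → f l ≡ (y +ℤ 𝟙 (l Fin.≟ i) *ℤ (f l -ℤ y)) +ℤ 𝟙 (l Fin.≟ j) *ℤ (f l -ℤ y)
  split l with l Fin.≟ i | l Fin.≟ j
  ... | yes l≡i | yes l≡j = contradiction (≡.trans (≡.sym l≡i) l≡j) i≢j
  ... | yes _   | no  _   = first (f l) y
  ... | no  _   | yes _   = second (f l) y
  ... | no  l≢i | no  l≢j = ≡.trans (generic l≢i l≢j) (neither (f l) y)

sum-one-exception : ∀ {n} (f : Fin (suc n) → ℤ) {i} y → (∀ {l} → l ≢ i → f l ≡ y) →
                    sumℤ f ≡ + n *ℤ y +ℤ f i
sum-one-exception {n} f {i} y generic = begin
  sumℤ f
    ≡⟨ sum-cong-≗ split ⟩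
  sumℤ (λ l → y +ℤ 𝟙 (l Fin.≟ i) *ℤ (f l -ℤ y))
    ≡⟨ ∑-distrib-+ (λ _ → y) (λ l → 𝟙 (l Fin.≟ i) *ℤ (f l -ℤ y)) ⟩
  sumℤ {suc n} (λ _ → y) +ℤ sumℤ (λ l → 𝟙 (l Fin.≟ i) *ℤ (f l -ℤ y))
    ≡⟨ ≡.cong₂ _+ℤ_ (sum-const (suc n) y) (sum-select i (λ l → f l -ℤ y)) ⟩
  + suc n *ℤ y +ℤ (f i -ℤ y)
    ≡⟨ ≡.cong (_+ℤ (f i -ℤ y)) (ℤ.suc-* (+ n) y) ⟩
  y +ℤ + n *ℤ y +ℤ (f i -ℤ y)
    ≡⟨ collect y (+ n *ℤ y) (f i) ⟩
  + n *ℤ y +ℤ f i ∎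
  where
  open ≡-Reasoning
  collect : ∀ y ny x → y +ℤ ny +ℤ (x -ℤ y) ≡ ny +ℤ x
  collect = ℤSolver.solve-∀
  exception : ∀ x y → x ≡ y +ℤ 1ℤ *ℤ (x -ℤ y)
  exception = ℤSolver.solve-∀
  ordinary : ∀ x y → y ≡ y +ℤ 0ℤ *ℤ (x -ℤ y)
  ordinary = ℤSolver.solve-∀
  split : ∀ l → f l ≡ y +ℤ 𝟙 (l Fin.≟ i) *ℤ (f l -ℤ y)
  split l with l Fin.≟ i
  ... | yes _   = exception (f l) y
  ... | no  l≢i = ≡.trans (generic l≢i) (ordinary (f l) y)

-- The interval is the image of `Fin w` under the injection j ↦ j + k, so counting the pairs (l , j)
-- with l = e j in both orders gives w.
sum-interval : ∀ {n} k w → 1 ℕ.≤ w → w ℕ.+ k ℕ.∸ 1 ℕ.< n →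
               sumℤ {n} (λ l → 𝟙 ((k ℕ.≤? toℕ l) ×-dec (toℕ l ℕ.≤? w ℕ.+ k ℕ.∸ 1))) ≡ + w
-- With the width written `suc w`, the endpoint reduces to `w + k`; from here on `w` is one less
-- than the width.
sum-interval {n} k (suc w) _ w+k<n = begin
  sumℤ {n} (λ l → 𝟙 ((k ℕ.≤? toℕ l) ×-dec (toℕ l ℕ.≤? w ℕ.+ k)))
    ≡⟨ sum-cong-≗ (λ l → ≡.trans
         (𝟙-cong (mk⇔ index value) ((k ℕ.≤? toℕ l) ×-dec (toℕ l ℕ.≤? w ℕ.+ k)) (Fin.any? (λ j → l Fin.≟ e j)))
         (≡.sym (sum-𝟙 (λ j → l Fin.≟ e j) (λ l≡eᵢ l≡eⱼ → e-injective (≡.trans (≡.sym l≡eᵢ) l≡eⱼ))))) ⟩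
  sumℤ {n} (λ l → sumℤ (λ j → 𝟙 (l Fin.≟ e j)))
    ≡⟨ ∑-comm {n} {suc w} (λ l j → 𝟙 (l Fin.≟ e j)) ⟩
  sumℤ (λ j → sumℤ {n} (λ l → 𝟙 (l Fin.≟ e j)))
    ≡⟨ sum-cong-≗ (λ j → ≡.trans (sum-cong-≗ λ l → ≡.sym (ℤ.*-identityʳ (𝟙 (l Fin.≟ e j)))) (sum-select (e j) (λ _ → 1ℤ))) ⟩
  sumℤ {suc w} (λ _ → 1ℤ)
    ≡⟨ ≡.trans (sum-const (suc w) 1ℤ) (ℤ.*-identityʳ (+ suc w)) ⟩
  + suc w ∎
  where
  open ≡-Reasoning
  j+k<n : ∀ (j : Fin (suc w)) → toℕ j ℕ.+ k ℕ.< n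
  j+k<n j = ℕ.≤-<-trans (ℕ.+-monoˡ-≤ k (ℕ.s≤s⁻¹ (Fin.toℕ<n j))) w+k<n
  e : Fin (suc w) → Fin n
  e j = Fin.fromℕ< (j+k<n j)
  toℕ-e : ∀ j → Fin.toℕ (e j) ≡ toℕ j ℕ.+ k
  toℕ-e j = Fin.toℕ-fromℕ< (j+k<n j)
  e-injective : ∀ {i j} → e i ≡ e j → i ≡ j
  e-injective {i} {j} eq = Fin.toℕ-injective (ℕ.+-cancelʳ-≡ k _ _
    (≡.trans (≡.sym (toℕ-e i)) (≡.trans (≡.cong toℕ eq) (toℕ-e j))))
  index : ∀ {l} → k ℕ.≤ toℕ l × toℕ l ℕ.≤ w ℕ.+ k → ∃[ j ] l ≡ e j
  index {l} (k≤l , l≤w+k) = Fin.fromℕ< l-k<1+w , Fin.toℕ-injective (≡.sym (≡.trans (toℕ-e _)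
    (≡.trans (≡.cong (ℕ._+ k) (Fin.toℕ-fromℕ< l-k<1+w)) (ℕ.m∸n+n≡m k≤l))))
    where
    l-k<1+w : toℕ l ℕ.∸ k ℕ.< suc w
    l-k<1+w = ℕ.s≤s (ℕ.≤-trans (ℕ.∸-monoˡ-≤ k l≤w+k) (ℕ.≤-reflexive (ℕ.m+n∸n≡m w k)))
  value : ∀ {l} → ∃[ j ] l ≡ e j → k ℕ.≤ toℕ l × toℕ l ℕ.≤ w ℕ.+ k
  value (j , ≡.refl) rewrite toℕ-e j = ℕ.m≤n+m k (toℕ j) , ℕ.+-monoˡ-≤ k (ℕ.s≤s⁻¹ (Fin.toℕ<n j))

-- Convolution of integer functions on a finite abelian group.

module GroupRing (G : AbelianGroup c ℓ) {N} (G≅N : HasOrder (AbelianGroup.setoid G) N) where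
  open AbelianGroup G
  open Algebra.Properties.AbelianGroup G using (⁻¹-anti-homo-∙; ⁻¹-involutive; ε⁻¹≈ε)
  open FiniteAbelianGroup G G≅N
  open FiniteSetoid setoid G≅N using (_≈?_)
  open Inverse G≅N using (to; to-cong; strictlyInverseˡ; strictlyInverseʳ) renaming (from to element)
  open Subset

  -- `ℤ[G]` contains every function on the carrier, even one that separates equal elements. A
  -- congruent one keeps its value when a point is replaced by its representative `element (to x)`.
  Congruent : ℤ[G] → Set _
  Congruent f = ∀ {x y} → x ≈ y → f x ≡ f y

  ⟦⟧-cong : (A : Subset G p) → Congruent ⟦ A ⟧
  ⟦⟧-cong A x≈y = 𝟙-cong (mk⇔ (resp A x≈y) (resp A (sym x≈y))) (Elem? A _) (Elem? A _)

  ∑∑ : ℤ[G] → ℤ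
  ∑∑ f = sumℤ (λ i → f (element i))

  ∑∑-cong : ∀ {f g} → f ≋ g → ∑∑ f ≡ ∑∑ g
  ∑∑-cong f≋g = sum-cong-≗ λ i → f≋g (element i)

  select : ∀ g {f} → Congruent f → ∑∑ (λ y → 𝟙 (y ≈? g) *ℤ f y) ≡ f g
  select g f-cong = ≡.trans
    (sum-𝟙-unique (λ i → element i ≈? g) (to g) (strictlyInverseʳ g)
      (λ eᵢ≈g → ≡.trans (≡.sym (strictlyInverseˡ _)) (to-cong eᵢ≈g)) _)
    (f-cong (strictlyInverseʳ g))

  reflect-involutive : ∀ x y → (y ⁻¹ ∙ x) ⁻¹ ∙ x ≈ y
  reflect-involutive x y = begin
    (y ⁻¹ ∙ x) ⁻¹ ∙ x      ≈⟨ ∙-congʳ (⁻¹-anti-homo-∙ (y ⁻¹) x) ⟩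
    (x ⁻¹ ∙ y ⁻¹ ⁻¹) ∙ x   ≈⟨ comm _ _ ⟩
    x ∙ (x ⁻¹ ∙ y ⁻¹ ⁻¹)   ≈⟨ assoc _ _ _ ⟨
    (x ∙ x ⁻¹) ∙ y ⁻¹ ⁻¹   ≈⟨ ∙-congʳ (inverseʳ x) ⟩
    ε ∙ y ⁻¹ ⁻¹            ≈⟨ identityˡ _ ⟩
    y ⁻¹ ⁻¹                ≈⟨ ⁻¹-involutive y ⟩
    y                      ∎
    where open import Relation.Binary.Reasoning.Setoid setoid

  reflect-cong : ∀ {x y z} → y ≈ z → y ⁻¹ ∙ x ≈ z ⁻¹ ∙ x
  reflect-cong y≈z = ∙-congʳ (⁻¹-cong y≈z)

  -- The map y ↦ y⁻¹ ∙ x is an involution, hence permutes the summation index. It exchanges the two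
  -- arguments of a convolution at x, which yields `⊛-comm`.
  ∑∑-reflect : ∀ x {f} → Congruent f → ∑∑ f ≡ ∑∑ (λ y → f (y ⁻¹ ∙ x))
  ∑∑-reflect x {f} f-cong = ≡.trans
    (sum-permute {N} {N} (λ i → f (element i)) (mk↔ₛ′ ρ ρ ρ-involutive ρ-involutive))
    (sum-cong-≗ {N} λ i → f-cong (strictlyInverseʳ (element i ⁻¹ ∙ x)))
    where
    ρ : Fin N → Fin N
    ρ i = to (element i ⁻¹ ∙ x)
    ρ-involutive : ∀ i → ρ (ρ i) ≡ i
    ρ-involutive i = ≡.trans
      (to-cong (trans (reflect-cong (strictlyInverseʳ _)) (reflect-involutive x (element i))))
      (strictlyInverseˡ i)

  ⊛-comm : ∀ {f g} → Congruent f → Congruent g → f ⊛ g ≋ g ⊛ f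
  ⊛-comm {f} {g} f-cong g-cong x = ≡.trans
    (∑∑-reflect x {λ y → f y *ℤ g (y ⁻¹ ∙ x)}
      (λ y≈z → ≡.cong₂ _*ℤ_ (f-cong y≈z) (g-cong (reflect-cong y≈z))))
    (sum-cong-≗ λ i → ≡.trans
      (≡.cong (f _ *ℤ_) (g-cong (reflect-involutive x (element i))))
      (ℤ.*-comm (f _) (g _)))

  ⊛-cong : ∀ {f f′ g g′} → f ≋ f′ → g ≋ g′ → f ⊛ g ≋ f′ ⊛ g′
  ⊛-cong f≋ g≋ x = sum-cong-≗ λ i → ≡.cong₂ _*ℤ_ (f≋ (element i)) (g≋ (element i ⁻¹ ∙ x))

  ∑-⊛ : ∀ {m} (f : Fin m → ℤ[G]) g → ∑ f ⊛ g ≋ ∑ (λ l → f l ⊛ g)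
  ∑-⊛ {m} f g x = ≡.trans
    (sum-cong-≗ λ i → *-distribʳ-sum (g (element i ⁻¹ ∙ x)) (λ l → f l (element i)))
    (∑-comm {N} {m} (λ i l → f l (element i) *ℤ g (element i ⁻¹ ∙ x)))

  ⊛-∑ : ∀ {m} f (g : Fin m → ℤ[G]) → f ⊛ ∑ g ≋ ∑ (λ l → f ⊛ g l)
  ⊛-∑ {m} f g x = ≡.trans
    (sum-cong-≗ λ i → *-distribˡ-sum (f (element i)) (λ l → g l (element i ⁻¹ ∙ x)))
    (∑-comm {N} {m} (λ i l → f (element i) *ℤ g l (element i ⁻¹ ∙ x)))

  ⊕-⊛ : ∀ f g h → (f ⊕ g) ⊛ h ≋ f ⊛ h ⊕ g ⊛ h
  ⊕-⊛ f g h x = ≡.trans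
    (sum-cong-≗ λ i → ℤ.*-distribʳ-+ (h (element i ⁻¹ ∙ x)) (f (element i)) (g (element i)))
    (∑-distrib-+ {N} _ _)

  ⊛-⊕ : ∀ f g h → f ⊛ (g ⊕ h) ≋ f ⊛ g ⊕ f ⊛ h
  ⊛-⊕ f g h x = ≡.trans
    (sum-cong-≗ λ i → ℤ.*-distribˡ-+ (f (element i)) (g (element i ⁻¹ ∙ x)) (h (element i ⁻¹ ∙ x)))
    (∑-distrib-+ {N} _ _)

  ·-⊛ : ∀ a f g → (a · f) ⊛ g ≋ a · (f ⊛ g)
  ·-⊛ a f g x = ≡.trans (sum-cong-≗ λ i → ℤ.*-assoc a (f (element i)) _) (≡.sym (*-distribˡ-sum {N} a _))

  ⊛-· : ∀ a f g → f ⊛ (a · g) ≋ a · (f ⊛ g)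
  ⊛-· a f g x = ≡.trans
    (sum-cong-≗ λ i → ≡.trans (≡.sym (ℤ.*-assoc (f (element i)) a _))
      (≡.trans (≡.cong (_*ℤ _) (ℤ.*-comm (f (element i)) a)) (ℤ.*-assoc a (f (element i)) _)))
    (≡.sym (*-distribˡ-sum {N} a _))

  ε-⊛ : ∀ {f} → Congruent f → ⟦ ｛ ε ｝ ⟧ ⊛ f ≋ f
  ε-⊛ {f} f-cong x = ≡.trans
    (select ε {λ y → f (y ⁻¹ ∙ x)} (λ y≈z → f-cong (reflect-cong y≈z)))
    (f-cong (trans (∙-congʳ ε⁻¹≈ε) (identityˡ x)))

  ⊛-ε : ∀ {f} → Congruent f → f ⊛ ⟦ ｛ ε ｝ ⟧ ≋ f
  ⊛-ε f-cong x = ≡.trans (⊛-comm f-cong (⟦⟧-cong ｛ ε ｝) x) (ε-⊛ f-cong x)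

  ∣∣≡∑∑ : (A : Subset G p) → + ∣ A ∣ ≡ ∑∑ ⟦ A ⟧
  ∣∣≡∑∑ A = ≡.trans (pos-sum (λ i → if does (Elem? A (element i)) then 1 else 0))
    (sum-cong-≗ λ i → if-float +_ (does (Elem? A (element i))))

  ∑∑-∑ : ∀ {m} (f : Fin m → ℤ[G]) → ∑∑ (∑ f) ≡ sumℤ (λ l → ∑∑ (f l))
  ∑∑-∑ {m} f = ∑-comm {N} {m} (λ i l → f l (element i))

  ∑∑-⊕ : ∀ f g → ∑∑ (f ⊕ g) ≡ ∑∑ f +ℤ ∑∑ g
  ∑∑-⊕ f g = ∑-distrib-+ {N} (λ i → f (element i)) (λ i → g (element i))

  ∑∑-· : ∀ a f → ∑∑ (a · f) ≡ a *ℤ ∑∑ f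
  ∑∑-· a f = ≡.sym (*-distribˡ-sum {N} a (λ i → f (element i)))

  ∑∑-｛｝ : ∀ g → ∑∑ ⟦ ｛ g ｝ ⟧ ≡ 1ℤ
  ∑∑-｛｝ g = ≡.trans (sum-cong-≗ λ i → ≡.sym (ℤ.*-identityʳ (⟦ ｛ g ｝ ⟧ (element i))))
    (select g {λ _ → 1ℤ} (λ _ → ≡.refl))

  -- Trades a sum over G weighted by `⟦ A ⟧` for a sum over m listed points. For a coset of a line,
  -- the list is indexed by the elements of R.
  record Enumerates {m} (e : Fin m → Carrier) (A : Subset G p) : Set (c ⊔ ℓ ⊔ p) where
    field
      injective : Injective _≡_ _≈_ e
      elements  : ∀ {x} → Elem A x ⇔ (∃[ i ] x ≈ e i)

    ⟦⟧≋∑ : ⟦ A ⟧ ≋ ∑ (λ i → ⟦ ｛ e i ｝ ⟧)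
    ⟦⟧≋∑ x = ≡.trans (𝟙-cong elements (Elem? A x) (Fin.any? (λ i → x ≈? e i)))
      (≡.sym (sum-𝟙 (λ i → x ≈? e i) (λ x≈eᵢ x≈eⱼ → injective (trans (sym x≈eᵢ) x≈eⱼ))))

    ∑∑-⟦⟧ : ∀ {f} → Congruent f → ∑∑ (λ y → ⟦ A ⟧ y *ℤ f y) ≡ sumℤ (λ i → f (e i))
    ∑∑-⟦⟧ {f} f-cong = begin
      ∑∑ (λ y → ⟦ A ⟧ y *ℤ f y)
        ≡⟨ sum-cong-≗ (λ j → ≡.trans (≡.cong (_*ℤ f (element j)) (⟦⟧≋∑ (element j)))
             (*-distribʳ-sum {m} _ _)) ⟩
      ∑∑ (λ y → sumℤ (λ i → 𝟙 (y ≈? e i) *ℤ f y))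
        ≡⟨ ∑-comm {N} {m} _ ⟩
      sumℤ (λ i → ∑∑ (λ y → 𝟙 (y ≈? e i) *ℤ f y))
        ≡⟨ sum-cong-≗ (λ i → select (e i) f-cong) ⟩
      sumℤ (λ i → f (e i)) ∎
      where open ≡-Reasoning

    ⟦⟧-⊛ : ∀ {f} → Congruent f → ⟦ A ⟧ ⊛ f ≋ (λ x → sumℤ (λ i → f (e i ⁻¹ ∙ x)))
    ⟦⟧-⊛ {f} f-cong x = ∑∑-⟦⟧ {λ y → f (y ⁻¹ ∙ x)} (λ y≈z → f-cong (reflect-cong y≈z))

    ∑∑-size : ∑∑ ⟦ A ⟧ ≡ + m
    ∑∑-size = ≡.trans (sum-cong-≗ λ j → ≡.sym (ℤ.*-identityʳ (⟦ A ⟧ (element j))))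
      (≡.trans (∑∑-⟦⟧ {λ _ → 1ℤ} (λ _ → ≡.refl))
        (≡.trans (sum-const m 1ℤ) (ℤ.*-identityʳ (+ m))))

-- Lines in H × H and the products of their cosets.

module Lines (𝓡 : FiniteChainRing c ℓ) {q} (a : Fin q → FiniteChainRing.Carrier 𝓡)
  (difference-invertible : DifferencesInvertible (FiniteChainRing.commutativeRing 𝓡) a)
  where
  open FiniteChainRing 𝓡 hiding (zero)
  open Construction 𝓡 a
  open GroupRing G G≅
  open Inverse hasOrder using (to; to-cong; strictlyInverseˡ; strictlyInverseʳ) renaming (from to element)
  module Gm = AbelianGroup G
  open Gm using (_∙_; ε; _⁻¹; ∙-congˡ; ∙-congʳ; ∙-cong) renaming (_≈_ to _≈ᴳ_)
  open Algebra.Properties.AbelianGroup G using (∙-cancelˡ)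
  open Algebra.Properties.CommutativeSemigroup Gm.commutativeSemigroup using (interchange)
  open Subset using (Elem; Elem?)

  ∙-moveˡ : ∀ {x y z} → x ⁻¹ ∙ y ≈ᴳ z → y ≈ᴳ x ∙ z
  ∙-moveˡ {x} {y} {z} eq = begin
    y                 ≈⟨ \\-leftDividesˡ x y ⟨
    x ∙ (x ⁻¹ ∙ y)    ≈⟨ ∙-congˡ {x} eq ⟩
    x ∙ z             ∎
    where
    open Algebra.Properties.AbelianGroup G using (\\-leftDividesˡ)
    open import Relation.Binary.Reasoning.Setoid Gm.setoid

  ∙-moveʳ : ∀ {x y z} → y ≈ᴳ x ∙ z → x ⁻¹ ∙ y ≈ᴳ z
  ∙-moveʳ {x} {y} {z} eq = Gm.trans (∙-congˡ {x ⁻¹} eq) (\\-leftDividesʳ x z)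
    where open Algebra.Properties.AbelianGroup G using (\\-leftDividesʳ)

  point-cong : ∀ b {x y} → x ≈ y → point b x ≈ᴳ point b y
  point-cong ∞          x≈y = refl , x≈y
  point-cong (finite b) x≈y = x≈y , *-congˡ x≈y

  point-injective : ∀ b {x y} → point b x ≈ᴳ point b y → x ≈ y
  point-injective ∞          (_ , x≈y) = x≈y
  point-injective (finite b) (x≈y , _) = x≈y

  point-+ : ∀ b x y → point b (x + y) ≈ᴳ point b x ∙ point b y
  point-+ ∞          x y = sym (+-identityˡ 0#) , refl
  point-+ (finite b) x y = refl , distribˡ b x y

  point-0 : ∀ b → point b 0# ≈ᴳ ε
  point-0 ∞          = refl , refl
  point-0 (finite b) = refl , zeroʳ b

  -- For each y this is a linear system in two unknowns. Its determinant is, up to sign,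
  -- `a i - a j`, or 1 if one of the lines has slope ∞.
  decompose : ∀ {l m} → l ≢ m → ∀ y →
              ∃[ r ] ∃[ s ] y ≈ᴳ point (label l) r ∙ point (label m) s
  decompose {zero}  {zero}  l≢m = contradiction ≡.refl l≢m
  decompose {zero}  {suc j} l≢m (y , z) = z - a j * y , y ,
    sym (+-identityˡ y) , sym (//-rightDividesˡ (a j * y) z)
    where open Algebra.Properties.Ring ring using (//-rightDividesˡ)
  decompose {suc i} {zero}  l≢m (y , z) = y , z - a i * y ,
    sym (+-identityʳ y) , sym (trans (+-comm _ _) (//-rightDividesˡ (a i * y) z))
    where open Algebra.Properties.Ring ring using (//-rightDividesˡ)
  decompose {suc i} {suc j} l≢m (y , z) = r , y - r , y≈ , sym (begin
    a i * r + a j * (y - r)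
      ≈⟨ +-congʳ (*-congʳ (//-rightDividesˡ (a j) (a i))) ⟨
    (e + a j) * r + a j * (y - r)
      ≈⟨ solve 5 (λ e aⱼ u x y-r → (e :+ aⱼ) :* (u :* x) :+ aⱼ :* y-r :=
            (e :* u) :* x :+ aⱼ :* (u :* x :+ y-r)) refl e (a j) u (z - a j * y) (y - r) ⟩
    (e * u) * (z - a j * y) + a j * (r + (y - r))
      ≈⟨ +-cong (trans (*-congʳ eu≈1) (*-identityˡ _)) (*-congˡ (sym y≈)) ⟩
    z - a j * y + a j * y
      ≈⟨ //-rightDividesˡ (a j * y) z ⟩
    z ∎)
    where
    open Algebra.Properties.Ring ring using (//-rightDividesˡ)
    open SemiringSolver commutativeSemiring using (solve; _:=_; _:+_; _:*_)
    open import Relation.Binary.Reasoning.Setoid setoid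
    e = a i - a j
    inv = difference-invertible (l≢m ∘ ≡.cong suc)
    u = proj₁ inv
    eu≈1 = proj₂ inv
    -- Subtracting `a j` times r + s = y from `a i * r + a j * s` = z leaves `e * r` =
    -- `z - a j * y`.
    r = u * (z - a j * y)
    y≈ : y ≈ r + (y - r)
    y≈ = sym (trans (+-comm _ _) (//-rightDividesˡ r y))

  -- The same elimination isolates a unit multiple of r. Comparing the first parameter suffices,
  -- because it names the point of the first line that is being counted.
  decompose-unique : ∀ {l m} → l ≢ m → ∀ {r s r′ s′} →
    point (label l) r ∙ point (label m) s ≈ᴳ point (label l) r′ ∙ point (label m) s′ → r ≈ r′
  decompose-unique {zero}  {zero}  l≢m = contradiction ≡.refl l≢m
  decompose-unique {zero}  {suc j} l≢m {r} {s} {r′} {s′} (eq₁ , eq₂) =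
    +-cancelʳ (a j * s) r r′ (trans eq₂ (+-congˡ (*-congˡ (sym s≈s′))))
    where
    open Algebra.Properties.Ring ring using (+-cancelˡ; +-cancelʳ)
    s≈s′ : s ≈ s′
    s≈s′ = +-cancelˡ 0# s s′ eq₁
  decompose-unique {suc i} {zero}  l≢m {r} {s} {r′} {s′} (eq₁ , eq₂) = +-cancelʳ 0# r r′ eq₁
    where open Algebra.Properties.Ring ring using (+-cancelʳ)
  decompose-unique {suc i} {suc j} l≢m {r} {s} {r′} {s′} (eq₁ , eq₂) = begin
    r             ≈⟨ undo ⟨
    u * (e * r)   ≈⟨ *-congˡ (+-cancelʳ (a j * (r + s)) _ _ (begin
      e * r + a j * (r + s)    ≈⟨ expand ⟩
      a i * r + a j * s        ≈⟨ eq₂ ⟩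
      a i * r′ + a j * s′      ≈⟨ expand ⟨
      e * r′ + a j * (r′ + s′) ≈⟨ +-congˡ (*-congˡ eq₁) ⟨
      e * r′ + a j * (r + s)   ∎)) ⟩
    u * (e * r′)  ≈⟨ undo ⟩
    r′            ∎
    where
    open Algebra.Properties.Ring ring using (//-rightDividesˡ; +-cancelʳ)
    open SemiringSolver commutativeSemiring using (solve; _:=_; _:+_; _:*_)
    open import Relation.Binary.Reasoning.Setoid setoid
    e = a i - a j
    inv = difference-invertible (l≢m ∘ ≡.cong suc)
    u = proj₁ inv
    undo : ∀ {x} → u * (e * x) ≈ x
    undo {x} = trans (sym (*-assoc u e x)) (trans (*-congʳ (trans (*-comm u e) (proj₂ inv))) (*-identityˡ x))
    expand : ∀ {x y} → e * x + a j * (x + y) ≈ a i * x + a j * y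
    expand {x} {y} = trans
      (solve 4 (λ e aⱼ x y → e :* x :+ aⱼ :* (x :+ y) := (e :+ aⱼ) :* x :+ aⱼ :* y) refl e (a j) x y)
      (+-congʳ (*-congʳ (//-rightDividesˡ (a j) (a i))))

  ∈coset⇔ : ∀ b {g x} → Elem (coset g (L b)) x ⇔ (∃[ r ] x ≈ᴳ g ∙ point b r)
  ∈coset⇔ b {g} = mk⇔
    (λ (h , (r , h≈) , x≈) → r , Gm.trans x≈ (∙-congˡ {g} h≈))
    (λ (r , x≈) → point b r , (r , Gm.refl) , x≈)

  coset-enumerates : ∀ g b → Enumerates (λ i → g ∙ point b (element i)) (coset g (L b))
  coset-enumerates g b = record
    { injective = λ {i} {j} eq → ≡.trans (≡.sym (strictlyInverseˡ i)) (≡.trans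
        (to-cong (point-injective b (∙-cancelˡ g _ _ eq))) (strictlyInverseˡ j))
    ; elements  = mk⇔
        (λ x∈ → let r , x≈ = Equivalence.to (∈coset⇔ b) x∈ in
          to r , Gm.trans x≈ (∙-congˡ {g} (point-cong b (sym (strictlyInverseʳ r)))))
        (λ (i , x≈) → Equivalence.from (∈coset⇔ b) (element i , x≈))
    }

  ∈L⇔∈coset : ∀ b {x} → Elem (L b) x ⇔ Elem (coset ε (L b)) x
  ∈L⇔∈coset b = mk⇔
    (λ (r , x≈) → Equivalence.from (∈coset⇔ b) (r , Gm.trans x≈ (Gm.sym (Gm.identityˡ _))))
    (λ x∈ → let r , x≈ = Equivalence.to (∈coset⇔ b) x∈ in r , Gm.trans x≈ (Gm.identityˡ _))

  -- The line itself is `τ ε l`, so diagonal and off-diagonal blocks become combinations of the same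
  -- functions, apart from a multiple of the origin.
  τ : |G| → Fin (suc q) → ℤ[G]
  τ g l = ⟦ coset g (L (label l)) ⟧

  τ-cong : ∀ g l → Congruent (τ g l)
  τ-cong g l = ⟦⟧-cong (coset g (L (label l)))

  -- The coefficient at x counts the ways to write (g ∙ h)⁻¹ ∙ x as a point of the first line plus a
  -- point of the second, and there is exactly one.
  τ⊛τ-transversal : ∀ {l m} → l ≢ m → ∀ g h → τ g l ⊛ τ h m ≋ λ _ → 1ℤ
  τ⊛τ-transversal {l} {m} l≢m g h x = ≡.trans
    (Enumerates.⟦⟧-⊛ (coset-enumerates g (label l)) (τ-cong h m) x)
    (≡.trans (sum-cong-≗ λ i → ≡.sym (ℤ.*-identityʳ (τ h m (e i ⁻¹ ∙ x))))
      (sum-𝟙-unique (λ i → Elem? (coset h (L (label m))) (e i ⁻¹ ∙ x)) (to r)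
        (Equivalence.from (meets (to r)) (s , Gm.trans y≈ (∙-congʳ {point (label m) s} (point-cong (label l) (sym (strictlyInverseʳ r))))))
        (λ {i} x∈ → let s′ , y≈′ = Equivalence.to (meets i) x∈ in
          ≡.trans (≡.sym (strictlyInverseˡ i))
            (to-cong (decompose-unique l≢m (Gm.trans (Gm.sym y≈′) y≈))))
        (λ _ → 1ℤ)))
    where
    e : Fin order → |G|
    e i = g ∙ point (label l) (element i)
    y = (g ∙ h) ⁻¹ ∙ x
    r = proj₁ (decompose l≢m y)
    s = proj₁ (proj₂ (decompose l≢m y))
    y≈ = proj₂ (proj₂ (decompose l≢m y))
    meets : ∀ i → Elem (coset h (L (label m))) (e i ⁻¹ ∙ x) ⇔
                  (∃[ s ] y ≈ᴳ point (label l) (element i) ∙ point (label m) s)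
    meets i = mk⇔
      (λ x∈ → let s , x≈ = Equivalence.to (∈coset⇔ (label m)) x∈ in
        s , ∙-moveʳ {g ∙ h} (Gm.trans (∙-moveˡ {e i} x≈) (interchange g _ h _)))
      (λ (s , y≈) → Equivalence.from (∈coset⇔ (label m))
        (s , ∙-moveʳ {e i} (Gm.trans (∙-moveˡ {g ∙ h} y≈) (Gm.sym (interchange g _ h _)))))

  -- Each of the |R| points of the coset differs from g by an element of the line, so translating
  -- the line by any of them gives the same coset.
  τ⊛τ-parallel : ∀ g l → τ g l ⊛ τ ε l ≋ (+ order) · τ g l
  τ⊛τ-parallel g l x = ≡.trans
    (Enumerates.⟦⟧-⊛ (coset-enumerates g b) (τ-cong ε l) x)
    (≡.trans
      (sum-cong-≗ λ i → 𝟙-cong (same i) (Elem? (coset ε (L b)) (e i ⁻¹ ∙ x)) (Elem? (coset g (L b)) x))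
      (sum-const order (τ g l x)))
    where
    b = label l
    e : Fin order → |G|
    e i = g ∙ point b (element i)
    collect : ∀ i s → e i ∙ (ε ∙ point b s) ≈ᴳ g ∙ point b (element i + s)
    collect i s = Gm.trans (∙-congˡ {e i} (Gm.identityˡ (point b s)))
      (Gm.trans (Gm.assoc g _ _) (∙-congˡ {g} (Gm.sym (point-+ b (element i) s))))
    same : ∀ i → Elem (coset ε (L b)) (e i ⁻¹ ∙ x) ⇔ Elem (coset g (L b)) x
    same i = mk⇔
      (λ x∈ → let s , x≈ = Equivalence.to (∈coset⇔ b) x∈ in
        Equivalence.from (∈coset⇔ b) (element i + s , Gm.trans (∙-moveˡ {e i} x≈) (collect i s)))
      (λ x∈ → let r , x≈ = Equivalence.to (∈coset⇔ b) x∈ in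
        Equivalence.from (∈coset⇔ b) (r - element i , ∙-moveʳ {e i} (Gm.trans x≈ (Gm.sym (Gm.trans
          (collect i (r - element i))
          (∙-congˡ {g} (point-cong b (trans (+-comm _ _) (//-rightDividesˡ (element i) r)))))))))
      where open Algebra.Properties.Ring ring using (//-rightDividesˡ)

  ∑∑-τ : ∀ g l → ∑∑ (τ g l) ≡ + order
  ∑∑-τ g l = Enumerates.∑∑-size (coset-enumerates g (label l))

  ∈L∩L⇒≈ε : ∀ {l m} → l ≢ m → ∀ {x} → Elem (L (label l)) x → Elem (L (label m)) x → x ≈ᴳ ε
  ∈L∩L⇒≈ε {l} {m} l≢m {x} (r , x≈) (s , x≈′) = begin
    x                                    ≈⟨ x≈ ⟩
    point (label l) r                    ≈⟨ point-cong (label l) r≈0 ⟩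
    point (label l) 0#                   ≈⟨ point-0 (label l) ⟩
    ε                                    ∎
    where
    open import Relation.Binary.Reasoning.Setoid Gm.setoid
    r≈0 : r ≈ 0#
    r≈0 = decompose-unique l≢m (begin
      point (label l) r ∙ point (label m) 0#   ≈⟨ ∙-cong x≈ (Gm.sym (point-0 (label m))) ⟨
      x ∙ ε                                    ≈⟨ Gm.comm x ε ⟩
      ε ∙ x                                    ≈⟨ ∙-cong (Gm.sym (point-0 (label l))) x≈′ ⟩
      point (label l) 0# ∙ point (label m) s   ∎)

  coset-sum : ∀ {z} → (Fin z → |G|) → Fin (suc q) → ℤ[G]
  coset-sum T l = ∑ (λ u → τ (T u) l)

  ⟦⋃-coset⟧ : ∀ {z} (T : Fin z → |G|) l →
              (∀ {u v} → u ≢ v → ¬ Elem (L (label l)) (T u -ᴳ T v)) →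
              ⟦ ⋃ {D = λ _ → ⊤} (λ _ → yes tt) (λ u → coset (T u) (L (label l))) ⟧ ≋ coset-sum T l
  ⟦⋃-coset⟧ T l distinct x = ≡.trans
    (≡.sym (sum-𝟙 (λ u → yes tt ×-dec Elem? (coset (T u) (L b)) x) unique))
    (sum-cong-≗ λ u → ≡.trans (𝟙-× (yes tt) (Elem? (coset (T u) (L b)) x)) (ℤ.*-identityˡ (τ (T u) l x)))
    where
    b = label l
    unique : ∀ {u v} → ⊤ × Elem (coset (T u) (L b)) x → ⊤ × Elem (coset (T v) (L b)) x → u ≡ v
    unique {u} {v} (_ , x∈u) (_ , x∈v) with u Fin.≟ v
    ... | yes u≡v = u≡v
    ... | no  u≢v =
      let r , x≈  = Equivalence.to (∈coset⇔ b) x∈u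
          s , x≈′ = Equivalence.to (∈coset⇔ b) x∈v
      -- From T u + point r = x = T v + point s it follows that T u - T v is the point of the line
      -- with parameter s - r.
      in contradiction (s - r , (begin
        T u -ᴳ T v
          ≈⟨ Gm.comm _ _ ⟩
        T v ⁻¹ ∙ T u
          ≈⟨ ∙-moveʳ {T v} (∙-cancelʳ (point b r) _ _ (begin
            T u ∙ point b r                     ≈⟨ x≈ ⟨
            x                                   ≈⟨ x≈′ ⟩
            T v ∙ point b s                     ≈⟨ ∙-congˡ {T v} (point-cong b (//-rightDividesˡ r s)) ⟨
            T v ∙ point b (s - r + r)           ≈⟨ ∙-congˡ {T v} (point-+ b (s - r) r) ⟩
            T v ∙ (point b (s - r) ∙ point b r) ≈⟨ Gm.assoc (T v) _ _ ⟨
            T v ∙ point b (s - r) ∙ point b r   ∎)) ⟩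
        point b (s - r) ∎)) (distinct u≢v)
      where
      open Algebra.Properties.AbelianGroup G using (∙-cancelʳ)
      open Algebra.Properties.Ring ring using (//-rightDividesˡ)
      open import Relation.Binary.Reasoning.Setoid Gm.setoid

  -- Merges the parallel and the transversal case into a constant plus a correction at m = l, so
  -- that a sum over m can be evaluated by `sum-select`.
  τ⊛τ : ∀ g l m → τ g l ⊛ τ ε m ≋ λ x → 1ℤ +ℤ 𝟙 (m Fin.≟ l) *ℤ (+ order *ℤ τ g l x -ℤ 1ℤ)
  τ⊛τ g l m x with m Fin.≟ l
  ... | yes ≡.refl = ≡.trans (τ⊛τ-parallel g l x) (lemma (+ order *ℤ τ g l x))
    where
    lemma : ∀ y → y ≡ 1ℤ +ℤ 1ℤ *ℤ (y -ℤ 1ℤ)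
    lemma = ℤSolver.solve-∀
  ... | no m≢l = ≡.trans (τ⊛τ-transversal (m≢l ∘ ≡.sym) g ε x) (lemma (+ order *ℤ τ g l x -ℤ 1ℤ))
    where
    lemma : ∀ y → 1ℤ ≡ 1ℤ +ℤ 0ℤ *ℤ y
    lemma = ℤSolver.solve-∀

  coset-sum⊛coset-sum : ∀ {z z′ l m} → l ≢ m → (T : Fin z → |G|) (T′ : Fin z′ → |G|) →
                        coset-sum T l ⊛ coset-sum T′ m ≋ λ _ → + z *ℤ + z′
  coset-sum⊛coset-sum {z} {z′} {l} {m} l≢m T T′ x = begin
    (coset-sum T l ⊛ coset-sum T′ m) x
      ≡⟨ ∑-⊛ (λ u → τ (T u) l) (coset-sum T′ m) x ⟩
    sumℤ (λ u → (τ (T u) l ⊛ coset-sum T′ m) x)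
      ≡⟨ sum-cong-≗ (λ u → ⊛-∑ (τ (T u) l) (λ v → τ (T′ v) m) x) ⟩
    sumℤ (λ u → sumℤ (λ v → (τ (T u) l ⊛ τ (T′ v) m) x))
      ≡⟨ sum-cong-≗ (λ u → sum-cong-≗ λ v → τ⊛τ-transversal l≢m (T u) (T′ v) x) ⟩
    sumℤ {z} (λ u → sumℤ {z′} (λ v → 1ℤ))
      ≡⟨ sum-cong-≗ {z} (λ u → ≡.trans (sum-const z′ 1ℤ) (ℤ.*-identityʳ (+ z′))) ⟩
    sumℤ {z} (λ u → + z′)
      ≡⟨ sum-const z (+ z′) ⟩
    + z *ℤ + z′ ∎
    where open ≡-Reasoning

  -- Unions of lines with the origin removed.

  module PencilOfLines {D : Pred (Fin (suc q)) p} (D? : Decidable D) where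

    size : ℤ
    size = sumℤ (λ l → 𝟙 (D? l))

    -- Distinct lines meet only in the origin. Their sum counts it once per line while the set omits
    -- it, whence the coefficient -`size`.
    pencil : ℤ[G]
    pencil = ∑ (λ l → 𝟙 (D? l) · τ ε l) ⊕ (ℤ.- size) · ⟦ ｛ 0ᴳ ｝ ⟧

    ⟦⋃-L∖0⟧ : ⟦ ⋃ D? (L ∘ label) ∖ ｛ 0ᴳ ｝ ⟧ ≋ pencil
    ⟦⋃-L∖0⟧ x = by-cases (Elem? ｛ 0ᴳ ｝ x)
      where
      open ≡-Reasoning
      U = ⋃ D? (L ∘ label)
      x∈L? : ∀ l → Dec (Elem (L (label l)) x)
      x∈L? l = Elem? (L (label l)) x
      ⟦L⟧≡τ : ∀ l → 𝟙 (x∈L? l) ≡ τ ε l x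
      ⟦L⟧≡τ l = 𝟙-cong (∈L⇔∈coset (label l)) (x∈L? l) (Elem? (coset ε (L (label l))) x)
      cancel : ∀ w → w +ℤ (ℤ.- w *ℤ 1ℤ) ≡ 0ℤ
      cancel = ℤSolver.solve-∀
      vanish : ∀ y w → y ≡ y +ℤ (ℤ.- w *ℤ 0ℤ)
      vanish = ℤSolver.solve-∀
      by-cases : Dec (x ≈ᴳ 0ᴳ) → ⟦ U ∖ ｛ 0ᴳ ｝ ⟧ x ≡ pencil x
      by-cases (yes x≈0) = begin
        ⟦ U ∖ ｛ 0ᴳ ｝ ⟧ x
          ≡⟨ 𝟙-false (Elem? (U ∖ ｛ 0ᴳ ｝) x) (λ (_ , x≉0) → x≉0 x≈0) ⟩
        0ℤ
          ≡⟨ cancel size ⟨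
        size +ℤ (ℤ.- size *ℤ 1ℤ)
          ≡⟨ ≡.cong₂ (λ s d → s +ℤ ℤ.- size *ℤ d)
               (sum-cong-≗ λ l → ≡.trans (≡.sym (ℤ.*-identityʳ (𝟙 (D? l)))) (≡.cong (𝟙 (D? l) *ℤ_)
                 (≡.trans (≡.sym (𝟙-true (x∈L? l) (0# , Gm.trans x≈0 (Gm.sym (point-0 (label l)))))) (⟦L⟧≡τ l))))
               (≡.sym (𝟙-true (Elem? ｛ 0ᴳ ｝ x) x≈0)) ⟩
        pencil x ∎
      by-cases (no x≉0) = begin
        ⟦ U ∖ ｛ 0ᴳ ｝ ⟧ x
          ≡⟨ 𝟙-cong (mk⇔ proj₁ (_, x≉0)) (Elem? (U ∖ ｛ 0ᴳ ｝) x) (Elem? U x) ⟩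
        𝟙 (Fin.any? (λ l → D? l ×-dec x∈L? l))
          ≡⟨ sum-𝟙 (λ l → D? l ×-dec x∈L? l) unique ⟨
        sumℤ (λ l → 𝟙 (D? l ×-dec x∈L? l))
          ≡⟨ sum-cong-≗ (λ l → ≡.trans (𝟙-× (D? l) (x∈L? l)) (≡.cong (𝟙 (D? l) *ℤ_) (⟦L⟧≡τ l))) ⟩
        sumℤ (λ l → 𝟙 (D? l) *ℤ τ ε l x)
          ≡⟨ vanish (sumℤ (λ l → 𝟙 (D? l) *ℤ τ ε l x)) size ⟩
        sumℤ (λ l → 𝟙 (D? l) *ℤ τ ε l x) +ℤ (ℤ.- size *ℤ 0ℤ)
          ≡⟨ ≡.cong (λ d → sumℤ (λ l → 𝟙 (D? l) *ℤ τ ε l x) +ℤ ℤ.- size *ℤ d) (𝟙-false (Elem? ｛ 0ᴳ ｝ x) x≉0) ⟨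
        pencil x ∎
        where
        unique : ∀ {l m} → D l × Elem (L (label l)) x → D m × Elem (L (label m)) x → l ≡ m
        unique {l} {m} (_ , x∈l) (_ , x∈m) with l Fin.≟ m
        ... | yes l≡m = l≡m
        ... | no  l≢m = contradiction (∈L∩L⇒≈ε l≢m x∈l x∈m) x≉0

    -- Each line of D other than l contributes G, the line l contributes |R| `τ g l` if it belongs
    -- to D, and the removed origin contributes -`size` times `τ g l`.
    τ⊛pencil : ∀ g l → τ g l ⊛ pencil ≋
               λ x → (size -ℤ 𝟙 (D? l)) +ℤ (+ order *ℤ 𝟙 (D? l) -ℤ size) *ℤ τ g l x
    τ⊛pencil g l x = begin
      (τ g l ⊛ pencil) x
        ≡⟨ ⊛-⊕ (τ g l) (∑ (λ m → 𝟙 (D? m) · τ ε m)) ((ℤ.- size) · ⟦ ｛ 0ᴳ ｝ ⟧) x ⟩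
      (τ g l ⊛ ∑ (λ m → 𝟙 (D? m) · τ ε m)) x +ℤ (τ g l ⊛ ((ℤ.- size) · ⟦ ｛ 0ᴳ ｝ ⟧)) x
        ≡⟨ ≡.cong₂ _+ℤ_
             (≡.trans (⊛-∑ (τ g l) (λ m → 𝟙 (D? m) · τ ε m) x)
               (sum-cong-≗ λ m → ≡.trans (⊛-· (𝟙 (D? m)) (τ g l) (τ ε m) x)
                 (≡.trans (≡.cong (𝟙 (D? m) *ℤ_) (τ⊛τ g l m x))
                   (distribute (𝟙 (D? m)) (𝟙 (m Fin.≟ l)) y))))
             (≡.trans (⊛-· (ℤ.- size) (τ g l) ⟦ ｛ 0ᴳ ｝ ⟧ x) (≡.cong (ℤ.- size *ℤ_) (⊛-ε (τ-cong g l) x))) ⟩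
      sumℤ (λ m → 𝟙 (D? m) +ℤ 𝟙 (m Fin.≟ l) *ℤ (𝟙 (D? m) *ℤ y)) +ℤ ℤ.- size *ℤ τ g l x
        ≡⟨ ≡.cong (_+ℤ ℤ.- size *ℤ τ g l x) (≡.trans
             (∑-distrib-+ (λ m → 𝟙 (D? m)) (λ m → 𝟙 (m Fin.≟ l) *ℤ (𝟙 (D? m) *ℤ y)))
             (≡.cong (size +ℤ_) (sum-select l (λ m → 𝟙 (D? m) *ℤ y)))) ⟩
      size +ℤ 𝟙 (D? l) *ℤ y +ℤ ℤ.- size *ℤ τ g l x
        ≡⟨ collect size (𝟙 (D? l)) (+ order) (τ g l x) ⟩
      (size -ℤ 𝟙 (D? l)) +ℤ (+ order *ℤ 𝟙 (D? l) -ℤ size) *ℤ τ g l x ∎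
      where
      open ≡-Reasoning
      y = + order *ℤ τ g l x -ℤ 1ℤ
      distribute : ∀ d e y → d *ℤ (1ℤ +ℤ e *ℤ y) ≡ d +ℤ e *ℤ (d *ℤ y)
      distribute = ℤSolver.solve-∀
      collect : ∀ w d Q t → w +ℤ d *ℤ (Q *ℤ t -ℤ 1ℤ) +ℤ ℤ.- w *ℤ t ≡ (w -ℤ d) +ℤ (Q *ℤ d -ℤ w) *ℤ t
      collect = ℤSolver.solve-∀

    coset-sum⊛pencil : ∀ {z} (T : Fin z → |G|) l → coset-sum T l ⊛ pencil ≋
      λ x → + z *ℤ (size -ℤ 𝟙 (D? l)) +ℤ (+ order *ℤ 𝟙 (D? l) -ℤ size) *ℤ coset-sum T l x
    coset-sum⊛pencil {z} T l x = begin
      (coset-sum T l ⊛ pencil) x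
        ≡⟨ ∑-⊛ (λ u → τ (T u) l) pencil x ⟩
      sumℤ (λ u → (τ (T u) l ⊛ pencil) x)
        ≡⟨ sum-cong-≗ (λ u → τ⊛pencil (T u) l x) ⟩
      sumℤ (λ u → (size -ℤ 𝟙 (D? l)) +ℤ (+ order *ℤ 𝟙 (D? l) -ℤ size) *ℤ τ (T u) l x)
        ≡⟨ ∑-distrib-+ {z} (λ _ → size -ℤ 𝟙 (D? l)) (λ u → β *ℤ τ (T u) l x) ⟩
      sumℤ {z} (λ u → size -ℤ 𝟙 (D? l)) +ℤ sumℤ (λ u → β *ℤ τ (T u) l x)
        ≡⟨ ≡.cong₂ _+ℤ_ (sum-const z (size -ℤ 𝟙 (D? l))) (≡.sym (*-distribˡ-sum β (λ u → τ (T u) l x))) ⟩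
      + z *ℤ (size -ℤ 𝟙 (D? l)) +ℤ (+ order *ℤ 𝟙 (D? l) -ℤ size) *ℤ coset-sum T l x ∎
      where
      open ≡-Reasoning
      β = + order *ℤ 𝟙 (D? l) -ℤ size

    pencil-cong : Congruent pencil
    pencil-cong {x} {y} x≈y = ≡.cong₂ (λ s d → s +ℤ ℤ.- size *ℤ d)
      (sum-cong-≗ λ l → ≡.cong (𝟙 (D? l) *ℤ_) (τ-cong ε l x≈y))
      (⟦⟧-cong ｛ 0ᴳ ｝ x≈y)

    pencil⊛pencil : pencil ⊛ pencil ≋ λ x →
      (size *ℤ size -ℤ size) +ℤ (+ order -ℤ + 2 *ℤ size) *ℤ pencil x
        +ℤ (+ order *ℤ size -ℤ size *ℤ size) *ℤ ⟦ ｛ 0ᴳ ｝ ⟧ x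
    pencil⊛pencil x = begin
      (pencil ⊛ pencil) x
        ≡⟨ ⊕-⊛ (∑ (λ l → 𝟙 (D? l) · τ ε l)) ((ℤ.- size) · ⟦ ｛ 0ᴳ ｝ ⟧) pencil x ⟩
      (∑ (λ l → 𝟙 (D? l) · τ ε l) ⊛ pencil) x +ℤ (((ℤ.- size) · ⟦ ｛ 0ᴳ ｝ ⟧) ⊛ pencil) x
        ≡⟨ ≡.cong₂ _+ℤ_
             (≡.trans (∑-⊛ (λ l → 𝟙 (D? l) · τ ε l) pencil x)
               (sum-cong-≗ λ l → ≡.trans (·-⊛ (𝟙 (D? l)) (τ ε l) pencil x)
                 (≡.trans (≡.cong (𝟙 (D? l) *ℤ_) (τ⊛pencil ε l x)) (simplify l))))
             (≡.trans (·-⊛ (ℤ.- size) ⟦ ｛ 0ᴳ ｝ ⟧ pencil x) (≡.cong (ℤ.- size *ℤ_) (ε-⊛ pencil-cong x))) ⟩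
      sumℤ (λ l → (size -ℤ 1ℤ) *ℤ 𝟙 (D? l) +ℤ (+ order -ℤ size) *ℤ (𝟙 (D? l) *ℤ τ ε l x)) +ℤ ℤ.- size *ℤ pencil x
        ≡⟨ ≡.cong (_+ℤ ℤ.- size *ℤ pencil x) (≡.trans
             (∑-distrib-+ (λ l → (size -ℤ 1ℤ) *ℤ 𝟙 (D? l)) (λ l → (+ order -ℤ size) *ℤ (𝟙 (D? l) *ℤ τ ε l x)))
             (≡.cong₂ _+ℤ_
               (≡.sym (*-distribˡ-sum (size -ℤ 1ℤ) (λ l → 𝟙 (D? l))))
               (≡.sym (*-distribˡ-sum (+ order -ℤ size) (λ l → 𝟙 (D? l) *ℤ τ ε l x))))) ⟩
      (size -ℤ 1ℤ) *ℤ size +ℤ (+ order -ℤ size) *ℤ t +ℤ ℤ.- size *ℤ pencil x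
        ≡⟨ collect size (+ order) t (⟦ ｛ 0ᴳ ｝ ⟧ x) ⟩
      _ ∎
      where
      open ≡-Reasoning
      t = sumℤ (λ l → 𝟙 (D? l) *ℤ τ ε l x)
      collect : ∀ w Q t e → (w -ℤ 1ℤ) *ℤ w +ℤ (Q -ℤ w) *ℤ t +ℤ ℤ.- w *ℤ (t +ℤ ℤ.- w *ℤ e) ≡
        (w *ℤ w -ℤ w) +ℤ (Q -ℤ + 2 *ℤ w) *ℤ (t +ℤ ℤ.- w *ℤ e) +ℤ (Q *ℤ w -ℤ w *ℤ w) *ℤ e
      collect = ℤSolver.solve-∀
      expand : ∀ d w Q t → d *ℤ ((w -ℤ d) +ℤ (Q *ℤ d -ℤ w) *ℤ t) ≡
        w *ℤ d -ℤ d *ℤ d +ℤ (Q *ℤ (d *ℤ d) -ℤ w *ℤ d) *ℤ t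
      expand = ℤSolver.solve-∀
      contract : ∀ d w Q t → w *ℤ d -ℤ d +ℤ (Q *ℤ d -ℤ w *ℤ d) *ℤ t ≡
        (w -ℤ 1ℤ) *ℤ d +ℤ (Q -ℤ w) *ℤ (d *ℤ t)
      contract = ℤSolver.solve-∀
      -- One indicator is the weight of the line, a second comes from its product with the pencil.
      -- The square is isolated so that idempotence, which is no ring identity, can be applied
      -- between two solver calls.
      simplify : ∀ l → _
      simplify l = ≡.trans (expand (𝟙 (D? l)) size (+ order) (τ ε l x)) (≡.trans
        (≡.cong (λ d → size *ℤ 𝟙 (D? l) -ℤ d +ℤ (+ order *ℤ d -ℤ size *ℤ 𝟙 (D? l)) *ℤ τ ε l x) (𝟙-idem (D? l)))
        (contract (𝟙 (D? l)) size (+ order) (τ ε l x)))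

    ∑∑-pencil : ∑∑ pencil ≡ size *ℤ + order -ℤ size
    ∑∑-pencil = begin
      ∑∑ pencil
        ≡⟨ ∑∑-⊕ (∑ (λ l → 𝟙 (D? l) · τ ε l)) ((ℤ.- size) · ⟦ ｛ 0ᴳ ｝ ⟧) ⟩
      ∑∑ (∑ (λ l → 𝟙 (D? l) · τ ε l)) +ℤ ∑∑ ((ℤ.- size) · ⟦ ｛ 0ᴳ ｝ ⟧)
        ≡⟨ ≡.cong₂ _+ℤ_
             (≡.trans (∑∑-∑ (λ l → 𝟙 (D? l) · τ ε l)) (sum-cong-≗ λ l →
               ≡.trans (∑∑-· (𝟙 (D? l)) (τ ε l)) (≡.cong (𝟙 (D? l) *ℤ_) (∑∑-τ ε l))))
             (≡.trans (∑∑-· (ℤ.- size) ⟦ ｛ 0ᴳ ｝ ⟧) (≡.cong (ℤ.- size *ℤ_) (∑∑-｛｝ 0ᴳ))) ⟩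
      sumℤ (λ l → 𝟙 (D? l) *ℤ + order) +ℤ ℤ.- size *ℤ 1ℤ
        ≡⟨ ≡.cong₂ _+ℤ_ (≡.sym (*-distribʳ-sum (+ order) (λ l → 𝟙 (D? l)))) (ℤ.*-identityʳ (ℤ.- size)) ⟩
      size *ℤ + order -ℤ size ∎
      where open ≡-Reasoning

  ∑∑-coset-sum : ∀ {z} (T : Fin z → |G|) l → ∑∑ (coset-sum T l) ≡ + z *ℤ + order
  ∑∑-coset-sum {z} T l = ≡.trans (∑∑-∑ (λ u → τ (T u) l))
    (≡.trans (sum-cong-≗ λ u → ∑∑-τ (T u) l) (sum-const z (+ order)))

  -- The blocks of the family: sizes and products.

  module Family {w z₁ z₂} (1≤w : 1 ℕ.≤ w) (w≤q : w ℕ.≤ q) (choice : Choice 1≤w w≤q z₁ z₂) where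
    open Choice choice

    A : Fin (suc z₁) → Pred (Fin (suc q)) _
    A i = D[ k i , w ℕ.+ k i ℕ.∸ 1 ]

    A? : ∀ i → Decidable (A i)
    A? i = D[ k i , w ℕ.+ k i ℕ.∸ 1 ]?

    open module Pencil i = PencilOfLines (A? i)

    size≡w : ∀ i → size i ≡ + w
    size≡w i = sum-interval (k i) w 1≤w (last-bound 1≤w w≤q (k-bounded i))

    -- The slope `b i j` as a label index, the form in which membership in an interval is expressed.
    -- The case split repeats that of `b`, so the two agree case by case.
    direction : Fin (suc z₁) → Fin (suc z₁) → Fin (suc q)
    direction i j with i Fin.<? j
    ... | yes _ = Fin.fromℕ< (first-bound 1≤w w≤q (k-bounded i))
    ... | no  _ = Fin.fromℕ< (last-bound 1≤w w≤q (k-bounded i))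

    b≡label : ∀ i j → b i j ≡ label (direction i j)
    b≡label i j with i Fin.<? j
    ... | yes _ = ≡.refl
    ... | no  _ = ≡.refl

    k≤w+k-1 : ∀ i → k i ℕ.≤ w ℕ.+ k i ℕ.∸ 1
    k≤w+k-1 i = ℕ.∸-monoˡ-≤ 1 (ℕ.+-monoˡ-≤ (k i) 1≤w)

    direction∈A : ∀ i j → A i (direction i j)
    direction∈A i j with i Fin.<? j
    ... | yes _ rewrite Fin.toℕ-fromℕ< (first-bound 1≤w w≤q (k-bounded i)) = ℕ.≤-refl , k≤w+k-1 i
    ... | no  _ rewrite Fin.toℕ-fromℕ< (last-bound 1≤w w≤q (k-bounded i)) = k≤w+k-1 i , ℕ.≤-refl

    -- All intervals have length w and their starts increase strictly. For i < j the first label of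
    -- A i precedes A j, and for i > j the last label of A i lies beyond A j.
    direction∉A : ∀ {i j} → i ≢ j → ¬ A j (direction i j)
    direction∉A {i} {j} i≢j with i Fin.<? j
    ... | yes i<j rewrite Fin.toℕ-fromℕ< (first-bound 1≤w w≤q (k-bounded i)) =
      λ (kⱼ≤kᵢ , _) → ℕ.<⇒≱ (k-increasing i<j) kⱼ≤kᵢ
    ... | no  i≮j rewrite Fin.toℕ-fromℕ< (last-bound 1≤w w≤q (k-bounded i)) =
      λ (_ , lastᵢ≤lastⱼ) → ℕ.<⇒≱
        (ℕ.∸-monoˡ-< (ℕ.+-monoʳ-< w (k-increasing (Fin.≤∧≢⇒< (ℕ.≮⇒≥ i≮j) (i≢j ∘ ≡.sym))))
                     (ℕ.≤-trans 1≤w (ℕ.m≤m+n w (k j))))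
        lastᵢ≤lastⱼ

    -- The index j is arbitrary, so j = i is allowed; that instance serves the diagonal equations.
    directions-differ : ∀ {i l} j → i ≢ l → direction l j ≢ direction i l
    directions-differ {i} {l} j i≢l eq = direction∉A i≢l (≡.subst (A l) eq (direction∈A l j))

    S-diagonal : ∀ i → S i i ≡ ⋃ (A? i) (L ∘ label) ∖ ｛ 0ᴳ ｝
    S-diagonal i with i Fin.≟ i
    ... | yes _   = ≡.refl
    ... | no  i≢i = contradiction ≡.refl i≢i

    S-off-diagonal : ∀ {i j} → i ≢ j →
      S i j ≡ ⋃ {D = λ _ → ⊤} (λ _ → yes tt) (λ u → coset (T i j u) (L (b i j)))
    S-off-diagonal {i} {j} i≢j with i Fin.≟ j
    ... | yes i≡j = contradiction i≡j i≢j
    ... | no  _   = ≡.refl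

    ⟦S⟧-diagonal : ∀ i → ⟦ S i i ⟧ ≋ pencil i
    ⟦S⟧-diagonal i x = ≡.trans (≡.cong (λ A → ⟦ A ⟧ x) (S-diagonal i)) (⟦⋃-L∖0⟧ i x)

    ⟦S⟧-off-diagonal : ∀ {i j} → i ≢ j → ⟦ S i j ⟧ ≋ coset-sum (T i j) (direction i j)
    ⟦S⟧-off-diagonal {i} {j} i≢j x = ≡.trans (≡.cong (λ A → ⟦ A ⟧ x) (S-off-diagonal i≢j))
      (lemma (b≡label i j) (T-distinct i≢j))
      where
      -- Generalizing over the slope lets the union and the distinctness hypothesis be rewritten
      -- together by one match on the equation.
      lemma : ∀ {b} → b ≡ label (direction i j) →
        (∀ {u v} → u ≢ v → ¬ Elem (L b) (T i j u -ᴳ T i j v)) →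
        ⟦ ⋃ {D = λ _ → ⊤} (λ _ → yes tt) (λ u → coset (T i j u) (L b)) ⟧ x ≡
        coset-sum (T i j) (direction i j) x
      lemma ≡.refl distinct = ⟦⋃-coset⟧ (T i j) (direction i j) distinct x

    private
      |R| W Z K : ℤ
      |R| = + order
      W = + w
      Z = + z₂
      K = + z₁

    ∣S∣-diagonal : ∀ i → + ∣ S i i ∣ ≡ W *ℤ |R| -ℤ W
    ∣S∣-diagonal i = ≡.trans (∣∣≡∑∑ (S i i)) (≡.trans (∑∑-cong (⟦S⟧-diagonal i))
      (≡.trans (∑∑-pencil i) (≡.cong (λ w → w *ℤ |R| -ℤ w) (size≡w i))))

    ∣S∣-off-diagonal : ∀ {i j} → i ≢ j → + ∣ S i j ∣ ≡ Z *ℤ |R|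
    ∣S∣-off-diagonal {i} {j} i≢j = ≡.trans (∣∣≡∑∑ (S i j))
      (≡.trans (∑∑-cong (⟦S⟧-off-diagonal i≢j)) (∑∑-coset-sum (T i j) (direction i j)))

    row-size : ∀ i → + Σℕ.sum (λ j → ∣ S i j ∣) ≡ K *ℤ (Z *ℤ |R|) +ℤ (W *ℤ |R| -ℤ W)
    row-size i = ≡.trans (pos-sum (λ j → ∣ S i j ∣)) (≡.trans
      (sum-one-exception (λ j → + ∣ S i j ∣) {i} (Z *ℤ |R|) (λ j≢i → ∣S∣-off-diagonal (j≢i ∘ ≡.sym)))
      (≡.cong (K *ℤ (Z *ℤ |R|) +ℤ_) (∣S∣-diagonal i)))

    column-size : ∀ i → + Σℕ.sum (λ j → ∣ S j i ∣) ≡ K *ℤ (Z *ℤ |R|) +ℤ (W *ℤ |R| -ℤ W)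
    column-size i = ≡.trans (pos-sum (λ j → ∣ S j i ∣)) (≡.trans
      (sum-one-exception (λ j → + ∣ S j i ∣) {i} (Z *ℤ |R|) ∣S∣-off-diagonal)
      (≡.cong (K *ℤ (Z *ℤ |R|) +ℤ_) (∣S∣-diagonal i)))

    S⊛S-off-diagonal : ∀ {i j l} → i ≢ l → l ≢ j → ⟦ S l j ⟧ ⊛ ⟦ S i l ⟧ ≋ λ _ → Z *ℤ Z
    S⊛S-off-diagonal {i} {j} {l} i≢l l≢j x = ≡.trans
      (⊛-cong (⟦S⟧-off-diagonal l≢j) (⟦S⟧-off-diagonal i≢l) x)
      (coset-sum⊛coset-sum (directions-differ j i≢l) (T l j) (T i l) x)

    -- With l left free, one formula covers both exceptional terms of an off-diagonal sum: the
    -- indicator is 1 for l = i and 0 for l = j.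
    S⊛S-diagonal : ∀ {i j} → i ≢ j → ∀ l x → (⟦ S i j ⟧ ⊛ ⟦ S l l ⟧) x ≡
      Z *ℤ (W -ℤ 𝟙 (A? l (direction i j))) +ℤ (|R| *ℤ 𝟙 (A? l (direction i j)) -ℤ W) *ℤ ⟦ S i j ⟧ x
    S⊛S-diagonal {i} {j} i≢j l x = ≡.trans
      (⊛-cong (⟦S⟧-off-diagonal i≢j) (⟦S⟧-diagonal l) x) (≡.trans
      (coset-sum⊛pencil l (T i j) (direction i j) x)
      (≡.cong₂ (λ w s → Z *ℤ (w -ℤ 𝟙 (A? l (direction i j))) +ℤ (|R| *ℤ 𝟙 (A? l (direction i j)) -ℤ w) *ℤ s)
        (size≡w l) (≡.sym (⟦S⟧-off-diagonal i≢j x))))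

    product-diagonal : ∀ i → ∑ (λ l → ⟦ S l i ⟧ ⊛ ⟦ S i l ⟧) ≋ λ x →
      (W *ℤ W -ℤ W +ℤ K *ℤ (Z *ℤ Z)) +ℤ (|R| -ℤ + 2 *ℤ W) *ℤ ⟦ S i i ⟧ x
        +ℤ (|R| *ℤ W -ℤ W *ℤ W) *ℤ ⟦ ｛ 0ᴳ ｝ ⟧ x
    product-diagonal i x = begin
      ∑ (λ l → ⟦ S l i ⟧ ⊛ ⟦ S i l ⟧) x
        ≡⟨ sum-one-exception (λ l → (⟦ S l i ⟧ ⊛ ⟦ S i l ⟧) x) {i} (Z *ℤ Z)
             (λ l≢i → S⊛S-off-diagonal (l≢i ∘ ≡.sym) l≢i x) ⟩
      K *ℤ (Z *ℤ Z) +ℤ (⟦ S i i ⟧ ⊛ ⟦ S i i ⟧) x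
        ≡⟨ ≡.cong (K *ℤ (Z *ℤ Z) +ℤ_) (≡.trans
             (⊛-cong (⟦S⟧-diagonal i) (⟦S⟧-diagonal i) x) (≡.trans (pencil⊛pencil i x)
             (≡.cong₂ (λ w s → (w *ℤ w -ℤ w) +ℤ (|R| -ℤ + 2 *ℤ w) *ℤ s +ℤ (|R| *ℤ w -ℤ w *ℤ w) *ℤ ⟦ ｛ 0ᴳ ｝ ⟧ x)
               (size≡w i) (≡.sym (⟦S⟧-diagonal i x))))) ⟩
      K *ℤ (Z *ℤ Z) +ℤ ((W *ℤ W -ℤ W) +ℤ (|R| -ℤ + 2 *ℤ W) *ℤ ⟦ S i i ⟧ x +ℤ (|R| *ℤ W -ℤ W *ℤ W) *ℤ ⟦ ｛ 0ᴳ ｝ ⟧ x)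
        ≡⟨ collect (K *ℤ (Z *ℤ Z)) (W *ℤ W -ℤ W) ((|R| -ℤ + 2 *ℤ W) *ℤ ⟦ S i i ⟧ x) ((|R| *ℤ W -ℤ W *ℤ W) *ℤ ⟦ ｛ 0ᴳ ｝ ⟧ x) ⟩
      _ ∎
      where
      open ≡-Reasoning
      collect : ∀ a b c d → a +ℤ (b +ℤ c +ℤ d) ≡ (b +ℤ a) +ℤ c +ℤ d
      collect = ℤSolver.solve-∀

    product-off-diagonal : ∀ {i j} → i ≢ j → ∑ (λ l → ⟦ S l j ⟧ ⊛ ⟦ S i l ⟧) ≋ λ x →
      (K *ℤ (Z *ℤ Z) -ℤ Z *ℤ Z +ℤ Z *ℤ (+ 2 *ℤ W -ℤ 1ℤ)) +ℤ (|R| -ℤ + 2 *ℤ W) *ℤ ⟦ S i j ⟧ x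
    product-off-diagonal {i} {j} i≢j x = begin
      ∑ (λ l → ⟦ S l j ⟧ ⊛ ⟦ S i l ⟧) x
        ≡⟨ sum-two-exceptions (λ l → (⟦ S l j ⟧ ⊛ ⟦ S i l ⟧) x) (Z *ℤ Z) i≢j
             (λ l≢i l≢j → S⊛S-off-diagonal (l≢i ∘ ≡.sym) l≢j x) ⟩
      + suc z₁ *ℤ (Z *ℤ Z) +ℤ ((⟦ S i j ⟧ ⊛ ⟦ S i i ⟧) x -ℤ Z *ℤ Z) +ℤ ((⟦ S j j ⟧ ⊛ ⟦ S i j ⟧) x -ℤ Z *ℤ Z)
        ≡⟨ ≡.cong₂ (λ y y′ → + suc z₁ *ℤ (Z *ℤ Z) +ℤ (y -ℤ Z *ℤ Z) +ℤ (y′ -ℤ Z *ℤ Z))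
             (≡.trans (S⊛S-diagonal i≢j i x)
               (≡.cong value (𝟙-true (A? i (direction i j)) (direction∈A i j))))
             -- At l = j the diagonal block is the left factor and has to be moved to the right.
             (≡.trans (⊛-comm (⟦⟧-cong (S j j)) (⟦⟧-cong (S i j)) x) (≡.trans (S⊛S-diagonal i≢j j x)
               (≡.cong value (𝟙-false (A? j (direction i j)) (direction∉A i≢j))))) ⟩
      + suc z₁ *ℤ (Z *ℤ Z) +ℤ (value 1ℤ -ℤ Z *ℤ Z) +ℤ (value 0ℤ -ℤ Z *ℤ Z)
        ≡⟨ ≡.cong (λ y → y +ℤ (value 1ℤ -ℤ Z *ℤ Z) +ℤ (value 0ℤ -ℤ Z *ℤ Z)) (ℤ.suc-* K (Z *ℤ Z)) ⟩
      (Z *ℤ Z +ℤ K *ℤ (Z *ℤ Z)) +ℤ (value 1ℤ -ℤ Z *ℤ Z) +ℤ (value 0ℤ -ℤ Z *ℤ Z)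
        ≡⟨ collect K Z W |R| (⟦ S i j ⟧ x) ⟩
      _ ∎
      where
      open ≡-Reasoning
      value : ℤ → ℤ
      value d = Z *ℤ (W -ℤ d) +ℤ (|R| *ℤ d -ℤ W) *ℤ ⟦ S i j ⟧ x
      collect : ∀ K Z W |R| s →
        (Z *ℤ Z +ℤ K *ℤ (Z *ℤ Z))
          +ℤ (Z *ℤ (W -ℤ 1ℤ) +ℤ (|R| *ℤ 1ℤ -ℤ W) *ℤ s -ℤ Z *ℤ Z)
          +ℤ (Z *ℤ (W -ℤ 0ℤ) +ℤ (|R| *ℤ 0ℤ -ℤ W) *ℤ s -ℤ Z *ℤ Z) ≡
        (K *ℤ (Z *ℤ Z) -ℤ Z *ℤ Z +ℤ Z *ℤ (+ 2 *ℤ W -ℤ 1ℤ)) +ℤ (|R| -ℤ + 2 *ℤ W) *ℤ s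
      collect = ℤSolver.solve-∀

    β₀ γ₀ lam₀ μ₀ t₀ obstruction : ℤ
    β₀ = |R| -ℤ + 2 *ℤ W
    γ₀ = |R| *ℤ W -ℤ W *ℤ W
    μ₀ = W *ℤ W -ℤ W +ℤ K *ℤ (Z *ℤ Z)
    lam₀ = μ₀ +ℤ β₀
    t₀ = μ₀ +ℤ γ₀
    -- The coefficient by which the off-diagonal products miss μ G + β S i j.
    obstruction = (Z -ℤ W) *ℤ (Z -ℤ W +ℤ 1ℤ)

    -- Taking the parameters together with equations keeps this computation in terms of |R|, while
    -- the caller may supply closed forms in pˢᵈ.
    hasParameters : ∀ {n k lam μ t} → order ℕ.* order ≡ n →
      + k ≡ K *ℤ (Z *ℤ |R|) +ℤ (W *ℤ |R| -ℤ W) → lam ≡ lam₀ → μ ≡ μ₀ → t ≡ t₀ →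
      obstruction ≡ 0ℤ → HasParameters (suc z₁) n k lam μ t S
    hasParameters order≡n k≡ ≡.refl ≡.refl ≡.refl obstruction≡0 = record
      { order≡n    = order≡n
      ; ε∉diagonal = λ i ε∈S → proj₂ (≡.subst (λ A → Elem A 0ᴳ) (S-diagonal i) ε∈S) Gm.refl
      ; row-sum    = λ i → ℤ.+-injective (≡.trans (row-size i) (≡.sym k≡))
      ; column-sum = λ i → ℤ.+-injective (≡.trans (column-size i) (≡.sym k≡))
      ; product    = λ i j → by-cases i j (i Fin.≟ j)
      }
      where
      open ≡-Reasoning
      rhs : ℤ → ℤ → ℤ → ℤ
      rhs d s e = μ₀ *ℤ 1ℤ +ℤ (lam₀ -ℤ μ₀) *ℤ s +ℤ (d *ℤ (t₀ -ℤ μ₀)) *ℤ e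
      diagonal : ∀ μ β γ s e → μ +ℤ β *ℤ s +ℤ γ *ℤ e ≡
        μ *ℤ 1ℤ +ℤ (μ +ℤ β -ℤ μ) *ℤ s +ℤ (1ℤ *ℤ (μ +ℤ γ -ℤ μ)) *ℤ e
      diagonal = ℤSolver.solve-∀
      -- Adding the obstruction completes the coefficient of G to μ₀; the multiples of s agree
      -- already and the origin term carries the factor 0.
      off-diagonal : ∀ K Z W β γ s e →
        K *ℤ (Z *ℤ Z) -ℤ Z *ℤ Z +ℤ Z *ℤ (+ 2 *ℤ W -ℤ 1ℤ) +ℤ β *ℤ s +ℤ (Z -ℤ W) *ℤ (Z -ℤ W +ℤ 1ℤ) ≡
        (W *ℤ W -ℤ W +ℤ K *ℤ (Z *ℤ Z)) *ℤ 1ℤ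
          +ℤ (W *ℤ W -ℤ W +ℤ K *ℤ (Z *ℤ Z) +ℤ β -ℤ (W *ℤ W -ℤ W +ℤ K *ℤ (Z *ℤ Z))) *ℤ s
          +ℤ (0ℤ *ℤ (W *ℤ W -ℤ W +ℤ K *ℤ (Z *ℤ Z) +ℤ γ -ℤ (W *ℤ W -ℤ W +ℤ K *ℤ (Z *ℤ Z)))) *ℤ e
      off-diagonal = ℤSolver.solve-∀
      by-cases : ∀ i j → Dec (i ≡ j) → ∀ x →
        ∑ (λ l → ⟦ S l j ⟧ ⊛ ⟦ S i l ⟧) x ≡ rhs (δ i j) (⟦ S i j ⟧ x) (⟦ ｛ 0ᴳ ｝ ⟧ x)
      by-cases i .i (yes ≡.refl) x = begin
        ∑ (λ l → ⟦ S l i ⟧ ⊛ ⟦ S i l ⟧) x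
          ≡⟨ product-diagonal i x ⟩
        μ₀ +ℤ β₀ *ℤ ⟦ S i i ⟧ x +ℤ γ₀ *ℤ ⟦ ｛ 0ᴳ ｝ ⟧ x
          ≡⟨ diagonal μ₀ β₀ γ₀ (⟦ S i i ⟧ x) (⟦ ｛ 0ᴳ ｝ ⟧ x) ⟩
        rhs 1ℤ (⟦ S i i ⟧ x) (⟦ ｛ 0ᴳ ｝ ⟧ x)
          ≡⟨ ≡.cong (λ d → rhs d (⟦ S i i ⟧ x) (⟦ ｛ 0ᴳ ｝ ⟧ x)) (𝟙-true (i Fin.≟ i) ≡.refl) ⟨
        rhs (δ i i) (⟦ S i i ⟧ x) (⟦ ｛ 0ᴳ ｝ ⟧ x) ∎
      by-cases i j (no i≢j) x = begin
        ∑ (λ l → ⟦ S l j ⟧ ⊛ ⟦ S i l ⟧) x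
          ≡⟨ product-off-diagonal i≢j x ⟩
        K *ℤ (Z *ℤ Z) -ℤ Z *ℤ Z +ℤ Z *ℤ (+ 2 *ℤ W -ℤ 1ℤ) +ℤ β₀ *ℤ ⟦ S i j ⟧ x
          ≡⟨ ≡.trans (≡.cong (lhs +ℤ_) obstruction≡0) (ℤ.+-identityʳ lhs) ⟨
        lhs +ℤ obstruction
          ≡⟨ off-diagonal K Z W β₀ γ₀ (⟦ S i j ⟧ x) (⟦ ｛ 0ᴳ ｝ ⟧ x) ⟩
        rhs 0ℤ (⟦ S i j ⟧ x) (⟦ ｛ 0ᴳ ｝ ⟧ x)
          ≡⟨ ≡.cong (λ d → rhs d (⟦ S i j ⟧ x) (⟦ ｛ 0ᴳ ｝ ⟧ x)) (𝟙-false (i Fin.≟ j) i≢j) ⟨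
        rhs (δ i j) (⟦ S i j ⟧ x) (⟦ ｛ 0ᴳ ｝ ⟧ x) ∎
        where
        lhs = K *ℤ (Z *ℤ Z) -ℤ Z *ℤ Z +ℤ Z *ℤ (+ 2 *ℤ W -ℤ 1ℤ) +ℤ β₀ *ℤ ⟦ S i j ⟧ x

    -- Necessity: the parameters are forced and the obstruction vanishes.

    module _ (1≉0 : ¬ 1# ≈ 0#) {i j : Fin (suc z₁)} (i≢j : i ≢ j)
      {n k lam μ t} (has : HasParameters (suc z₁) n k lam μ t S) where
      open HasParameters has using (product)

      private
        point≉0 : ∀ l → ¬ point (label l) 1# ≈ᴳ 0ᴳ
        point≉0 l eq = 1≉0 (point-injective (label l) (Gm.trans eq (Gm.sym (point-0 (label l)))))

        -- The slope b_ij belongs to A_i and b_ji does not, so a nonzero point on each of these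
        -- lines separates `S i i` from its complement.
        inside outside : |G|
        inside  = point (label (direction i j)) 1#
        outside = point (label (direction j i)) 1#

        ⟦S⟧-inside : ⟦ S i i ⟧ inside ≡ 1ℤ
        ⟦S⟧-inside = 𝟙-true (Elem? (S i i) inside) (≡.subst (λ A → Elem A inside) (≡.sym (S-diagonal i))
          ((direction i j , direction∈A i j , 1# , Gm.refl) , point≉0 (direction i j)))

        ⟦S⟧-outside : ⟦ S i i ⟧ outside ≡ 0ℤ
        ⟦S⟧-outside = 𝟙-false (Elem? (S i i) outside) λ outside∈ →
          let (l , l∈A , outside∈L) , outside≉0 = ≡.subst (λ A → Elem A outside) (S-diagonal i) outside∈
          in outside≉0 (∈L∩L⇒≈ε
               (λ l≡ → direction∉A (i≢j ∘ ≡.sym) (≡.subst (A i) l≡ l∈A))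
               outside∈L (1# , Gm.refl))

        ⟦S⟧-0 : ⟦ S i i ⟧ 0ᴳ ≡ 0ℤ
        ⟦S⟧-0 = 𝟙-false (Elem? (S i i) 0ᴳ) (HasParameters.ε∉diagonal has i)

        evaluate : ∀ x {s e} → ⟦ S i i ⟧ x ≡ s → ⟦ ｛ 0ᴳ ｝ ⟧ x ≡ e →
          μ₀ +ℤ β₀ *ℤ s +ℤ γ₀ *ℤ e ≡ μ *ℤ 1ℤ +ℤ (lam -ℤ μ) *ℤ s +ℤ (1ℤ *ℤ (t -ℤ μ)) *ℤ e
        evaluate x ≡.refl ≡.refl = ≡.trans (≡.sym (product-diagonal i x)) (≡.trans (product i i x)
          (≡.cong (λ d → μ *ℤ 1ℤ +ℤ (lam -ℤ μ) *ℤ ⟦ S i i ⟧ x +ℤ (d *ℤ (t -ℤ μ)) *ℤ ⟦ ｛ 0ᴳ ｝ ⟧ x)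
            (𝟙-true (i Fin.≟ i) ≡.refl)))

      μ≡μ₀ : μ ≡ μ₀
      μ≡μ₀ = ≡.sym (≡.trans (lhs μ₀ β₀ γ₀)
        (≡.trans (evaluate outside ⟦S⟧-outside (𝟙-false (Elem? ｛ 0ᴳ ｝ outside) (point≉0 (direction j i)))) (rhs μ lam t)))
        where
        lhs : ∀ μ β γ → μ ≡ μ +ℤ β *ℤ 0ℤ +ℤ γ *ℤ 0ℤ
        lhs = ℤSolver.solve-∀
        rhs : ∀ μ lam t → μ *ℤ 1ℤ +ℤ (lam -ℤ μ) *ℤ 0ℤ +ℤ (1ℤ *ℤ (t -ℤ μ)) *ℤ 0ℤ ≡ μ
        rhs = ℤSolver.solve-∀

      lam≡lam₀ : lam ≡ lam₀
      lam≡lam₀ = ≡.sym (≡.trans (lhs μ₀ β₀ γ₀)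
        (≡.trans (evaluate inside ⟦S⟧-inside (𝟙-false (Elem? ｛ 0ᴳ ｝ inside) (point≉0 (direction i j)))) (rhs μ lam t)))
        where
        lhs : ∀ μ β γ → μ +ℤ β ≡ μ +ℤ β *ℤ 1ℤ +ℤ γ *ℤ 0ℤ
        lhs = ℤSolver.solve-∀
        rhs : ∀ μ lam t → μ *ℤ 1ℤ +ℤ (lam -ℤ μ) *ℤ 1ℤ +ℤ (1ℤ *ℤ (t -ℤ μ)) *ℤ 0ℤ ≡ lam
        rhs = ℤSolver.solve-∀

      t≡t₀ : t ≡ t₀
      t≡t₀ = ≡.sym (≡.trans (lhs μ₀ β₀ γ₀)
        (≡.trans (evaluate 0ᴳ ⟦S⟧-0 (𝟙-true (Elem? ｛ 0ᴳ ｝ 0ᴳ) Gm.refl)) (rhs μ lam t)))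
        where
        lhs : ∀ μ β γ → μ +ℤ γ ≡ μ +ℤ β *ℤ 0ℤ +ℤ γ *ℤ 1ℤ
        lhs = ℤSolver.solve-∀
        rhs : ∀ μ lam t → μ *ℤ 1ℤ +ℤ (lam -ℤ μ) *ℤ 0ℤ +ℤ (1ℤ *ℤ (t -ℤ μ)) *ℤ 1ℤ ≡ t
        rhs = ℤSolver.solve-∀

      k≡k₀ : + k ≡ K *ℤ (Z *ℤ |R|) +ℤ (W *ℤ |R| -ℤ W)
      k≡k₀ = ≡.trans (≡.cong +_ (≡.sym (HasParameters.row-sum has i))) (row-size i)

      -- Once μ and λ are known, the multiples of `S i j` cancel, so evaluating the off-diagonal
      -- equation at one point is enough; 0ᴳ is an arbitrary choice.
      obstruction≡0 : obstruction ≡ 0ℤ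
      obstruction≡0 = begin
        obstruction
          ≡⟨ difference K Z W β₀ t s e ⟩
        (μ₀ *ℤ 1ℤ +ℤ (lam₀ -ℤ μ₀) *ℤ s +ℤ (0ℤ *ℤ (t -ℤ μ₀)) *ℤ e) -ℤ lhs
          ≡⟨ ≡.cong₂ (λ m l → (m *ℤ 1ℤ +ℤ (l -ℤ m) *ℤ s +ℤ (0ℤ *ℤ (t -ℤ m)) *ℤ e) -ℤ lhs) μ≡μ₀ lam≡lam₀ ⟨
        (μ *ℤ 1ℤ +ℤ (lam -ℤ μ) *ℤ s +ℤ (0ℤ *ℤ (t -ℤ μ)) *ℤ e) -ℤ lhs
          ≡⟨ ≡.cong (λ d → (μ *ℤ 1ℤ +ℤ (lam -ℤ μ) *ℤ s +ℤ (d *ℤ (t -ℤ μ)) *ℤ e) -ℤ lhs) (𝟙-false (i Fin.≟ j) i≢j) ⟨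
        (μ *ℤ 1ℤ +ℤ (lam -ℤ μ) *ℤ s +ℤ (δ i j *ℤ (t -ℤ μ)) *ℤ e) -ℤ lhs
          ≡⟨ ℤ.i≡j⇒i-j≡0 (≡.trans (≡.sym (product i j 0ᴳ)) (product-off-diagonal i≢j 0ᴳ)) ⟩
        0ℤ ∎
        where
        open ≡-Reasoning
        s = ⟦ S i j ⟧ 0ᴳ
        e = ⟦ ｛ 0ᴳ ｝ ⟧ 0ᴳ
        lhs = K *ℤ (Z *ℤ Z) -ℤ Z *ℤ Z +ℤ Z *ℤ (+ 2 *ℤ W -ℤ 1ℤ) +ℤ β₀ *ℤ s
        difference : ∀ K Z W β t s e → (Z -ℤ W) *ℤ (Z -ℤ W +ℤ 1ℤ) ≡
          ((W *ℤ W -ℤ W +ℤ K *ℤ (Z *ℤ Z)) *ℤ 1ℤ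
            +ℤ (W *ℤ W -ℤ W +ℤ K *ℤ (Z *ℤ Z) +ℤ β -ℤ (W *ℤ W -ℤ W +ℤ K *ℤ (Z *ℤ Z))) *ℤ s
            +ℤ (0ℤ *ℤ (t -ℤ (W *ℤ W -ℤ W +ℤ K *ℤ (Z *ℤ Z)))) *ℤ e)
          -ℤ (K *ℤ (Z *ℤ Z) -ℤ Z *ℤ Z +ℤ Z *ℤ (+ 2 *ℤ W -ℤ 1ℤ) +ℤ β *ℤ s)
        difference = ℤSolver.solve-∀

-- The roots of the obstruction and the closed forms of the parameters.

open import Data.Nat.Base using (_+_; _*_; _∸_; _^_; _≤_)

-- As ℤ has no zero divisors, the roots are z = w and z + 1 = w. When w = 1 the latter gives z = 0,
-- contrary to 1 ≤ z, so both cases of the criterion come from one equation.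
condition⇔obstruction≡0 : ∀ {w z} → 1 ≤ w → 1 ≤ z →
  ((2 ≤ w → z ≡ w ∸ 1 ⊎ z ≡ w) × (w ≡ 1 → z ≡ 1)) ⇔ ((+ z -ℤ + w) *ℤ (+ z -ℤ + w +ℤ 1ℤ) ≡ 0ℤ)
condition⇔obstruction≡0 {w} {z} 1≤w 1≤z = mk⇔ (λ (2≤w⇒ , w≡1⇒) → root 2≤w⇒ w≡1⇒) condition
  where
  next-root : + z -ℤ + w +ℤ 1ℤ ≡ + suc z -ℤ + w
  next-root = rearrange (+ z) (+ w)
    where
    rearrange : ∀ Z W → Z -ℤ W +ℤ 1ℤ ≡ 1ℤ +ℤ Z -ℤ W
    rearrange = ℤSolver.solve-∀

  z≡w⇒root : z ≡ w → (+ z -ℤ + w) *ℤ (+ z -ℤ + w +ℤ 1ℤ) ≡ 0ℤ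
  z≡w⇒root z≡w = ≡.trans (≡.cong (_*ℤ (+ z -ℤ + w +ℤ 1ℤ)) (ℤ.i≡j⇒i-j≡0 (≡.cong +_ z≡w)))
    (ℤ.*-zeroˡ (+ z -ℤ + w +ℤ 1ℤ))

  1+z≡w⇒root : suc z ≡ w → (+ z -ℤ + w) *ℤ (+ z -ℤ + w +ℤ 1ℤ) ≡ 0ℤ
  1+z≡w⇒root 1+z≡w = ≡.trans (≡.cong ((+ z -ℤ + w) *ℤ_) (≡.trans next-root (ℤ.i≡j⇒i-j≡0 (≡.cong +_ 1+z≡w))))
    (ℤ.*-zeroʳ (+ z -ℤ + w))

  root : (2 ≤ w → z ≡ w ∸ 1 ⊎ z ≡ w) → (w ≡ 1 → z ≡ 1) → (+ z -ℤ + w) *ℤ (+ z -ℤ + w +ℤ 1ℤ) ≡ 0ℤ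
  root 2≤w⇒ w≡1⇒ with ℕ.m≤n⇒m<n∨m≡n 1≤w
  ... | inj₂ 1≡w = z≡w⇒root (≡.trans (w≡1⇒ (≡.sym 1≡w)) 1≡w)
  ... | inj₁ 2≤w with 2≤w⇒ 2≤w
  ...   | inj₁ z≡w∸1 = 1+z≡w⇒root (≡.trans (≡.cong suc z≡w∸1) (ℕ.m+[n∸m]≡n 1≤w))
  ...   | inj₂ z≡w   = z≡w⇒root z≡w

  condition : (+ z -ℤ + w) *ℤ (+ z -ℤ + w +ℤ 1ℤ) ≡ 0ℤ → (2 ≤ w → z ≡ w ∸ 1 ⊎ z ≡ w) × (w ≡ 1 → z ≡ 1)
  condition eq with ℤ.i*j≡0⇒i≡0∨j≡0 (+ z -ℤ + w) eq
  ... | inj₁ z-w≡0 = (λ _ → inj₂ z≡w) , (λ w≡1 → ≡.trans z≡w w≡1)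
    where
    z≡w : z ≡ w
    z≡w = ℤ.+-injective (ℤ.i-j≡0⇒i≡j (+ z) (+ w) z-w≡0)
  ... | inj₂ z-w+1≡0 = (λ _ → inj₁ (≡.cong (_∸ 1) 1+z≡w)) ,
      (λ w≡1 → contradiction (≡.subst (1 ≤_) (ℕ.suc-injective (≡.trans 1+z≡w w≡1)) 1≤z) ℕ.1+n≰n)
    where
    1+z≡w : suc z ≡ w
    1+z≡w = ℤ.+-injective (ℤ.i-j≡0⇒i≡j (+ suc z) (+ w) (≡.trans (≡.sym next-root) z-w+1≡0))

module _ (N w z₁ z₂ : ℕ) where
  private
    square : ∀ n → + (n ^ 2) ≡ + n *ℤ + n
    square n = ≡.trans (≡.cong (λ m → + (n * m)) (ℕ.*-identityʳ n)) (ℤ.pos-* n n)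

    z₁z₂² : + (z₁ * z₂ ^ 2) ≡ + z₁ *ℤ (+ z₂ *ℤ + z₂)
    z₁z₂² = ≡.trans (ℤ.pos-* z₁ (z₂ ^ 2)) (≡.cong (+ z₁ *ℤ_) (square z₂))

  k-value : 1 ≤ N → + ((N ∸ 1) * w + z₁ * z₂ * N) ≡ + z₁ *ℤ (+ z₂ *ℤ + N) +ℤ (+ w *ℤ + N -ℤ + w)
  k-value 1≤N = begin
    + ((N ∸ 1) * w + z₁ * z₂ * N)
      ≡⟨ ℤ.pos-+ ((N ∸ 1) * w) (z₁ * z₂ * N) ⟩
    + ((N ∸ 1) * w) +ℤ + (z₁ * z₂ * N)
      ≡⟨ ≡.cong₂ _+ℤ_
           (≡.trans (ℤ.pos-* (N ∸ 1) w) (≡.cong (_*ℤ + w) (≡.sym (ℤ.⊖-≥ 1≤N))))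
           (≡.trans (ℤ.pos-* (z₁ * z₂) N) (≡.cong (_*ℤ + N) (ℤ.pos-* z₁ z₂))) ⟩
    (N ℤ.⊖ 1) *ℤ + w +ℤ + z₁ *ℤ + z₂ *ℤ + N
      ≡⟨ ≡.cong (λ y → y *ℤ + w +ℤ + z₁ *ℤ + z₂ *ℤ + N) (≡.sym (ℤ.m-n≡m⊖n N 1)) ⟩
    (+ N -ℤ 1ℤ) *ℤ + w +ℤ + z₁ *ℤ + z₂ *ℤ + N
      ≡⟨ rearrange (+ N) (+ w) (+ z₁) (+ z₂) ⟩
    + z₁ *ℤ (+ z₂ *ℤ + N) +ℤ (+ w *ℤ + N -ℤ + w) ∎
    where
    open ≡-Reasoning
    rearrange : ∀ N w z₁ z₂ → (N -ℤ 1ℤ) *ℤ w +ℤ z₁ *ℤ z₂ *ℤ N ≡ z₁ *ℤ (z₂ *ℤ N) +ℤ (w *ℤ N -ℤ w)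
    rearrange = ℤSolver.solve-∀

  μ-value : + (w ^ 2) -ℤ + w +ℤ + (z₁ * z₂ ^ 2) ≡ + w *ℤ + w -ℤ + w +ℤ + z₁ *ℤ (+ z₂ *ℤ + z₂)
  μ-value = ≡.cong₂ (λ x y → x -ℤ + w +ℤ y) (square w) z₁z₂²

  lam-value : + N +ℤ + (w ^ 2) -ℤ + (3 * w) +ℤ + (z₁ * z₂ ^ 2) ≡
              + w *ℤ + w -ℤ + w +ℤ + z₁ *ℤ (+ z₂ *ℤ + z₂) +ℤ (+ N -ℤ + 2 *ℤ + w)
  lam-value = ≡.trans
    (≡.cong₂ (λ x y → x +ℤ y) (≡.cong₂ (λ x y → + N +ℤ x -ℤ y) (square w) (ℤ.pos-* 3 w)) z₁z₂²)
    (rearrange (+ N) (+ w) (+ z₁ *ℤ (+ z₂ *ℤ + z₂)))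
    where
    rearrange : ∀ N w y → N +ℤ w *ℤ w -ℤ + 3 *ℤ w +ℤ y ≡ w *ℤ w -ℤ w +ℤ y +ℤ (N -ℤ + 2 *ℤ w)
    rearrange = ℤSolver.solve-∀

  t-value : + (N * w) -ℤ + w +ℤ + (z₁ * z₂ ^ 2) ≡
            + w *ℤ + w -ℤ + w +ℤ + z₁ *ℤ (+ z₂ *ℤ + z₂) +ℤ (+ N *ℤ + w -ℤ + w *ℤ + w)
  t-value = ≡.trans (≡.cong₂ (λ x y → x -ℤ + w +ℤ y) (ℤ.pos-* N w) z₁z₂²)
    (rearrange (+ N) (+ w) (+ z₁ *ℤ (+ z₂ *ℤ + z₂)))
    where
    rearrange : ∀ N w y → N *ℤ w -ℤ w +ℤ y ≡ w *ℤ w -ℤ w +ℤ y +ℤ (N *ℤ w -ℤ w *ℤ w)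
    rearrange = ℤSolver.solve-∀

lemma3p2 :
    ∀ {c ℓ} (𝓡 : FiniteChainRing c ℓ) →
    let R   = FiniteChainRing.commutativeRing 𝓡
        π   = FiniteChainRing.π 𝓡
        I   = FiniteChainRing.I 𝓡
        R/I = R / I
    in
    ∀ (p s d r : ℕ) → Prime p → 1 ≤ s → 1 ≤ d → 1 ≤ r → r ≤ s →
    ¬ IsZero (I ^ᴵ (s ∸ 1)) → IsZero (I ^ᴵ s) →
    Associated R (natural R p) (power R π r) →
    IsField R/I → HasOrder (CommutativeRing.setoid R/I) (p ^ d) →
    ∀ (w z₁ z₂ : ℕ) (1≤w : 1 ≤ w) (w≤pᵈ : w ≤ p ^ d) →
    1 ≤ z₁ → z₁ ≤ p ^ d ∸ w + 1 → 1 ≤ z₂ → z₂ ≤ p ^ (s * d) →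
    ∀ (a : Fin (p ^ d) → CommutativeRing.Carrier R) → IsCosetRepresentatives R I a →
    let open Construction 𝓡 a in
    ∀ (choice : Choice 1≤w w≤pᵈ z₁ z₂) →
    let S = Choice.S choice
        Condition = (2 ≤ w → z₂ ≡ w ∸ 1 ⊎ z₂ ≡ w) × (w ≡ 1 → z₂ ≡ 1)
        n   = p ^ (2 * s * d)
        k   = (p ^ (s * d) ∸ 1) * w + z₁ * z₂ * p ^ (s * d)
        lam = + (p ^ (s * d)) +ℤ + (w ^ 2) -ℤ + (3 * w) +ℤ + (z₁ * z₂ ^ 2)
        μ   = + (w ^ 2) -ℤ + w +ℤ + (z₁ * z₂ ^ 2)
        t   = + (p ^ (s * d) * w) -ℤ + w +ℤ + (z₁ * z₂ ^ 2)
    in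
    (IsPartialSumFamily S ⇔ Condition) ×
    (Condition →
      HasParameters (suc z₁) n k lam μ t S ×
      (∀ {n′ k′ lam′ μ′ t′} → HasParameters (suc z₁) n′ k′ lam′ μ′ t′ S →
        (n′ , k′ , lam′ , μ′ , t′) ≡ (n , k , lam , μ , t)))
-- Matching on successors makes `s ∸ 1` reduce to `s′` and provides the two indices 0 and 1 at which
-- necessity is tested.
lemma3p2 𝓡 p s@(suc s′) d r p-prime 1≤s 1≤d 1≤r r≤s Iˢ⁻¹≉0 Iˢ≈0 _ R/I-field _
         w z₁@(suc _) z₂ 1≤w w≤pᵈ 1≤z₁ _ 1≤z₂ _ a a-reps choice =
    mk⇔ to-condition (λ condition → _ , _ , _ , _ , _ , parameters condition)
  , (λ condition → parameters condition , unique)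
  where
  open FiniteChainRing 𝓡 using (order; hasOrder; π; 1#; 0#; _≈_; trans; sym; *-congʳ; *-identityˡ; zeroˡ) renaming (commutativeRing to R)
  open NilpotentPrincipal R π
  open Construction 𝓡 a using (module HasParameters; HasParameters; module Choice)

  πˢ≈0 : power R π s ≈ 0#
  πˢ≈0 = IsZero⇒power≈0 s Iˢ≈0

  πˢ⁻¹≉0 : ¬ power R π s′ ≈ 0#
  πˢ⁻¹≉0 πˢ⁻¹≈0 = Iˢ⁻¹≉0 (power≈0⇒IsZero s′ πˢ⁻¹≈0)

  1≉0 : ¬ 1# ≈ 0#
  1≉0 1≈0 = πˢ⁻¹≉0 (trans (sym (*-identityˡ _)) (trans (*-congʳ 1≈0) (zeroˡ _)))

  open Lines 𝓡 a (difference-invertible {s} πˢ≈0 R/I-field a-reps)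
  open Family 1≤w w≤pᵈ choice

  0≢1 : _≢_ {A = Fin (suc z₁)} zero (suc zero)
  0≢1 ()

  order≡pˢᵈ : order ≡ p ^ (s * d)
  order≡pˢᵈ = ≡.trans (order≡qˢ {s} πˢ≈0 R/I-field a-reps ≡.refl πˢ⁻¹≉0 hasOrder)
    (≡.trans (ℕ.^-*-assoc p d s) (≡.cong (p ^_) (ℕ.*-comm d s)))

  order²≡p²ˢᵈ : order * order ≡ p ^ (2 * s * d)
  order²≡p²ˢᵈ = ≡.trans (≡.cong₂ _*_ order≡pˢᵈ order≡pˢᵈ) (≡.trans
    (≡.sym (ℕ.^-distribˡ-+-* p (s * d) (s * d))) (≡.cong (p ^_) (double s d)))
    where
    double : ∀ s d → s * d + s * d ≡ 2 * s * d
    double = ℕSolver.solve-∀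

  condition⇔ = condition⇔obstruction≡0 1≤w 1≤z₂

  N = p ^ (s * d)

  k≡ : + ((N ∸ 1) * w + z₁ * z₂ * N) ≡ + z₁ *ℤ (+ z₂ *ℤ + order) +ℤ (+ w *ℤ + order -ℤ + w)
  k≡ = ≡.subst (λ M → + ((N ∸ 1) * w + z₁ * z₂ * N) ≡ + z₁ *ℤ (+ z₂ *ℤ + M) +ℤ (+ w *ℤ + M -ℤ + w))
    (≡.sym order≡pˢᵈ)
    (k-value N w z₁ z₂ (ℕ.m^n>0 p {{ℕ.nonTrivial⇒nonZero p {{prime⇒nonTrivial p-prime}}}} (s * d)))

  lam≡ : + N +ℤ + (w ^ 2) -ℤ + (3 * w) +ℤ + (z₁ * z₂ ^ 2) ≡ lam₀
  lam≡ = ≡.subst (λ M → + M +ℤ + (w ^ 2) -ℤ + (3 * w) +ℤ + (z₁ * z₂ ^ 2) ≡ lam₀)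
    order≡pˢᵈ (lam-value order w z₁ z₂)

  t≡ : + (N * w) -ℤ + w +ℤ + (z₁ * z₂ ^ 2) ≡ t₀
  t≡ = ≡.subst (λ M → + (M * w) -ℤ + w +ℤ + (z₁ * z₂ ^ 2) ≡ t₀)
    order≡pˢᵈ (t-value order w z₁ z₂)

  Condition : Set
  Condition = (2 ≤ w → z₂ ≡ w ∸ 1 ⊎ z₂ ≡ w) × (w ≡ 1 → z₂ ≡ 1)

  to-condition : _ → Condition
  to-condition (_ , _ , _ , _ , _ , has) = Equivalence.from condition⇔ (obstruction≡0 1≉0 0≢1 has)

  parameters : Condition → HasParameters (suc z₁) (p ^ (2 * s * d))
    ((N ∸ 1) * w + z₁ * z₂ * N)
    (+ N +ℤ + (w ^ 2) -ℤ + (3 * w) +ℤ + (z₁ * z₂ ^ 2))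
    (+ (w ^ 2) -ℤ + w +ℤ + (z₁ * z₂ ^ 2))
    (+ (N * w) -ℤ + w +ℤ + (z₁ * z₂ ^ 2)) (Choice.S choice)
  parameters condition = hasParameters order²≡p²ˢᵈ k≡ lam≡ (μ-value order w z₁ z₂) t≡
    (Equivalence.to condition⇔ condition)

  unique : ∀ {n′ k′ lam′ μ′ t′} → HasParameters (suc z₁) n′ k′ lam′ μ′ t′ (Choice.S choice) →
    (n′ , k′ , lam′ , μ′ , t′) ≡
    ( p ^ (2 * s * d)
    , (N ∸ 1) * w + z₁ * z₂ * N
    , + N +ℤ + (w ^ 2) -ℤ + (3 * w) +ℤ + (z₁ * z₂ ^ 2)
    , + (w ^ 2) -ℤ + w +ℤ + (z₁ * z₂ ^ 2)
    , + (N * w) -ℤ + w +ℤ + (z₁ * z₂ ^ 2))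
  unique has = tuple≡
    (≡.trans (≡.sym (HasParameters.order≡n has)) order²≡p²ˢᵈ)
    (ℤ.+-injective (≡.trans (k≡k₀ 1≉0 0≢1 has) (≡.sym k≡)))
    (≡.trans (lam≡lam₀ 1≉0 0≢1 has) (≡.sym lam≡))
    (≡.trans (μ≡μ₀ 1≉0 0≢1 has) (≡.sym (μ-value order w z₁ z₂)))
    (≡.trans (t≡t₀ 1≉0 0≢1 has) (≡.sym t≡))
    where
    tuple≡ : ∀ {n n′ k k′ : ℕ} {lam lam′ μ μ′ t t′ : ℤ} →
      n ≡ n′ → k ≡ k′ → lam ≡ lam′ → μ ≡ μ′ → t ≡ t′ →
      (n , k , lam , μ , t) ≡ (n′ , k′ , lam′ , μ′ , t′)
    tuple≡ ≡.refl ≡.refl ≡.refl ≡.refl ≡.refl = ≡.refl
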